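{- Every automorphism-free tree $T$ can be obtained from $E_7$ by successively adjoining a leaf at a time in such a way that each intermediate tree is also automorphism-free.
   Context: All graphs are finite and simple. A tree $T$ with $|V(T)|\ge 2$ is automorphism-free if it has no automorphism other than the identity (an automorphism being a bijection of the vertex set preserving adjacency and non-adjacency). $E_7$ is the tree on 7 vertices consisting of a vertex $c$ of degree three together with three paths attached at $c$ having $1$, $2$ and $3$ vertices respectively (i.e. the spider with legs of lengths $1,2,3$). -}

module Defs where

open import Data.Nat using (ℕ; zero; suc; _≤_)
open import Data.Fin using (Fin; zero; suc; _≟_; toℕ)
open import Data.Bool using (Bool; true; false; not; _∧_; _∨_)
open import Data.Bool.Properties using (∨-comm)
open import Data.List using (List; []; _∷_; _++_; [_]; length)
open import Data.List.Relation.Unary.Unique.Propositional using (Unique)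
open import Data.Product using (Σ; ∃; _×_; _,_)
open import Data.Unit using (⊤)
open import Function.Bundles using (_↔_; Inverse)
open import Relation.Nullary using (yes; no)
open import Relation.Nullary.Decidable using (⌊_⌋)
open import Relation.Binary.PropositionalEquality using (_≡_; refl; sym; cong₂)

_==_ : ∀ {n} → Fin n → Fin n → Bool
i == j = ⌊ i ≟ j ⌋

==-refl : ∀ {n} (i : Fin n) → (i == i) ≡ true
==-refl i with i ≟ i
... | yes _ = refl
... | no ¬p = Data.Empty.⊥-elim (¬p refl)
  where import Data.Empty

==-sym : ∀ {n} (i j : Fin n) → (i == j) ≡ (j == i)
==-sym i j with i ≟ j | j ≟ i
... | yes _ | yes _ = refl
... | no _  | no _  = refl
... | yes p | no ¬q = Data.Empty.⊥-elim (¬q (sym p))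
  where import Data.Empty
... | no ¬p | yes q = Data.Empty.⊥-elim (¬p (sym q))
  where import Data.Empty

record Graph : Set where
  field
    size  : ℕ
    adj   : Fin size → Fin size → Bool
    adj-sym : ∀ u v → adj u v ≡ adj v u
    irrefl : ∀ v → adj v v ≡ false
open Graph public

mkGraph : (n : ℕ) → (Fin n → Fin n → Bool) → Graph
mkGraph n r = record
  { size = n
  ; adj = λ i j → not (i == j) ∧ (r i j ∨ r j i)
  ; adj-sym = λ i j → cong₂ (λ a b → not a ∧ b) (==-sym i j) (∨-comm (r i j) (r j i))
  ; irrefl = λ i → lem i
  }
  where
  lem : ∀ i → not (i == i) ∧ (r i i ∨ r i i) ≡ false
  lem i rewrite ==-refl i = refl

data Reach (G : Graph) : Fin (size G) → Fin (size G) → Set where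
  here  : ∀ {u} → Reach G u u
  there : ∀ {u w v} → adj G u w ≡ true → Reach G w v → Reach G u v

Connected : Graph → Set
Connected G = ∀ u v → Reach G u v

Chain : (G : Graph) → List (Fin (size G)) → Set
Chain G [] = ⊤
Chain G (x ∷ []) = ⊤
Chain G (x ∷ y ∷ r) = (adj G x y ≡ true) × Chain G (y ∷ r)

HasCycle : Graph → Set
HasCycle G = Σ (Fin (size G)) λ x → Σ (List (Fin (size G))) λ xs →
  Unique (x ∷ xs) × (2 ≤ length xs) × Chain G (x ∷ xs ++ [ x ])

IsTree : Graph → Set
IsTree G = Connected G × (HasCycle G → Data.Empty.⊥)
  where import Data.Empty

_≅_ : Graph → Graph → Set
G ≅ H = Σ (Fin (size G) ↔ Fin (size H)) λ f →
  ∀ u v → adj H (Inverse.to f u) (Inverse.to f v) ≡ adj G u v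

Automorphism : Graph → Set
Automorphism G = G ≅ G

AutFree : Graph → Set
AutFree G = (2 ≤ size G) × (∀ (σ : Automorphism G) v → Inverse.to (Data.Product.proj₁ σ) v ≡ v)
  where import Data.Product

addLeaf : (G : Graph) → Fin (size G) → Graph
addLeaf G v = record
  { size = suc (size G)
  ; adj = a
  ; adj-sym = s
  ; irrefl = ir
  }
  where
  a : Fin (suc (size G)) → Fin (suc (size G)) → Bool
  a zero zero = false
  a zero (suc j) = j == v
  a (suc i) zero = i == v
  a (suc i) (suc j) = adj G i j
  s : ∀ u w → a u w ≡ a w u
  s zero zero = refl
  s zero (suc j) = refl
  s (suc i) zero = refl
  s (suc i) (suc j) = Graph.adj-sym G i j
  ir : ∀ u → a u u ≡ false
  ir zero = refl
  ir (suc i) = irrefl G i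

-- E₇: centre 0, legs 0–1, 0–2–3, 0–4–5–6
E7-edge : ℕ → ℕ → Bool
E7-edge 0 1 = true
E7-edge 0 2 = true
E7-edge 2 3 = true
E7-edge 0 4 = true
E7-edge 4 5 = true
E7-edge 5 6 = true
E7-edge _ _ = false

E7 : Graph
E7 = mkGraph 7 (λ i j → E7-edge (toℕ i) (toℕ j))

data Buildable : Graph → Set where
  base : ∀ {G} → E7 ≅ G → Buildable G
  step : ∀ {G H} → Buildable G → (v : Fin (size G)) →
         addLeaf G v ≅ H → AutFree H → Buildable H

module Submission where

-- Root the tree at its centroid.  A rooted tree is rigid exactly when its branches are
-- rigid and pairwise non-isomorphic, so it stays rigid when a leaf is pruned (recursively)
-- from a smallest branch.  The pruned tree is automorphism-free unless it
-- consists of two isomorphic halves or, when there were two centroids, the pruned half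
-- becomes isomorphic to a branch of the other half.  Such a coincidence
-- determines the tree almost completely.  For halves a and b of equal order, b is the
-- pruned a with an edge added at the root; if a were likewise obtained from b, then
-- a ≅ b, so pruning b works.  For a single centroid, the largest branch is a copy of
-- the pruned rest of the tree, and pruning that branch works, except when the smallest
-- branch is a leaf and there are only three branches: then the middle
-- branch is pruned, which fails for E₇ alone.

open import Defs
open import Data.Bool using (true)
open import Data.Bool.Properties using (⇔→≡) renaming (_≟_ to _≟ᵇ_)
open import Data.Empty using (⊥; ⊥-elim)
open import Data.Fin using (Fin; zero; suc; punchIn; punchOut; toℕ)
open import Data.Fin.Permutation using (↔⇒≡)
open import Data.Fin.Properties
  using (1↔⊤; +↔⊎; all?; any?; injective⇒≤; punchIn-injective; punchInᵢ≢i; punchIn-punchOut)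
  renaming (_≟_ to _≟ᶠ_)
open import Data.List using (List; []; _∷_; _++_; [_]; length; map; take; lookup)
import Data.List.Membership.DecPropositional as DecMembership
open import Data.List.Membership.Propositional using (_∈_)
open import Data.List.Membership.Propositional.Properties using (∈-lookup)
open import Data.List.Properties using (length-map; map-++)
open import Data.List.Relation.Unary.All as All using ([]; _∷_)
open import Data.List.Relation.Unary.All.Properties using (¬Any⇒All¬)
open import Data.List.Relation.Unary.AllPairs using ([]; _∷_)
open import Data.List.Relation.Unary.Any using (here; there; index)
open import Data.List.Relation.Unary.Unique.Propositional using (Unique)
open import Data.List.Relation.Unary.Unique.Propositional.Properties using (map⁺; take⁺)
open import Data.Maybe as Maybe using (Maybe; just; nothing)
open import Data.Nat using (ℕ; zero; suc; pred; _+_; _≤_; _<_; z≤n; s≤s; _<?_; >-nonZero)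
open import Data.Nat.Properties
  using (_≟_; suc-injective; suc-pred; n≮0; ≤-refl; ≤-reflexive; ≤-trans; ≤-total; ≤-pred;
         ≤-<-trans; ≤∧≢⇒<; <-trans; <-irrefl; <⇒≤; <⇒≢; <⇒≱; ≰⇒>; ≮⇒≥; n≤1+n; m≤m+n; m≤n+m; m<m+n;
         m<n+m; +-comm; +-suc; +-mono-≤; +-mono-≤-<; +-monoˡ-≤; +-monoʳ-≤; +-cancelˡ-≤)
open import Data.Product using (∃; ∃₂; Σ-syntax; _×_; _,_; proj₁; proj₂)
open import Data.Sum using (_⊎_; inj₁; inj₂)
open import Data.Sum.Function.Propositional using (_⊎-↔_)
open import Data.Unit using (tt)
open import Function.Bundles using (Inverse; _↔_; mk↔ₛ′; mk⇔)
open import Function.Properties.Inverse using (↔-sym; ↔-trans)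
open import Relation.Binary.PropositionalEquality using (_≡_; refl; sym; trans; cong; cong₂; subst; subst₂)
open import Relation.Nullary using (¬_; Dec; yes; no; does)
open import Relation.Nullary.Decidable
  using (⌊_⌋; dec-true; dec-false; does-⇔; decidable-stable; toWitness; ¬?; _×-dec_)

-- Graphs with propositional edges, and their isomorphisms

record RelGraph : Set₁ where
  field
    V : Set
    E : V → V → Set

open RelGraph

record Iso (X Y : RelGraph) : Set where
  field
    to      : V X → V Y
    from    : V Y → V X
    to-from : ∀ y → to (from y) ≡ y
    from-to : ∀ x → from (to x) ≡ x
    to-E    : ∀ {x x′} → E X x x′ → E Y (to x) (to x′)
    from-E  : ∀ {y y′} → E Y y y′ → E X (from y) (from y′)

open Iso

to-injective : ∀ {X Y} (φ : Iso X Y) {x x′} → to φ x ≡ to φ x′ → x ≡ x′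
to-injective φ {x} {x′} p = trans (sym (from-to φ x)) (trans (cong (from φ) p) (from-to φ x′))

Iso-refl : ∀ {X} → Iso X X
Iso-refl = record
  { to = λ x → x ; from = λ x → x ; to-from = λ _ → refl ; from-to = λ _ → refl
  ; to-E = λ e → e ; from-E = λ e → e }

Iso-sym : ∀ {X Y} → Iso X Y → Iso Y X
Iso-sym φ = record
  { to = from φ ; from = to φ ; to-from = from-to φ ; from-to = to-from φ
  ; to-E = from-E φ ; from-E = to-E φ }

Iso-trans : ∀ {X Y Z} → Iso X Y → Iso Y Z → Iso X Z
Iso-trans φ ψ = record
  { to      = λ x → to ψ (to φ x)
  ; from    = λ z → from φ (from ψ z)
  ; to-from = λ z → trans (cong (to ψ) (to-from φ (from ψ z))) (to-from ψ z)
  ; from-to = λ x → trans (cong (from φ) (from-to ψ (to φ x))) (from-to φ x)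
  ; to-E    = λ e → to-E ψ (to-E φ e)
  ; from-E  = λ e → from-E φ (from-E ψ e)
  }

-- Rooted trees, their vertices and edges

infixr 5 _▷_

-- A rooted tree: a ▷ b hangs the tree a as a new branch at the root of b.  As an
-- unrooted tree it joins a and b by an edge between their roots, so moving
-- the root along that edge turns a ▷ b into b ▷ a.
data Tree : Set where
  •   : Tree
  _▷_ : Tree → Tree → Tree

data Vertex : Tree → Set where
  point : Vertex •
  inˡ   : ∀ {a b} → Vertex a → Vertex (a ▷ b)
  inʳ   : ∀ {a b} → Vertex b → Vertex (a ▷ b)

-- A predicate instead of an equation with `root t`, so that matching on an edge shows at once where
-- its ends lie.
data Root : ∀ {t} → Vertex t → Set where
  point : Root point
  inʳ   : ∀ {a b} {y : Vertex b} → Root y → Root (inʳ {a} y)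

data _~_ : ∀ {t} → Vertex t → Vertex t → Set where
  inˡ : ∀ {a b} {x y : Vertex a} → x ~ y → inˡ {a} {b} x ~ inˡ y
  inʳ : ∀ {a b} {x y : Vertex b} → x ~ y → inʳ {a} {b} x ~ inʳ y
  lr  : ∀ {a b} {x : Vertex a} {y : Vertex b} → Root x → Root y → inˡ x ~ inʳ y
  rl  : ∀ {a b} {x : Vertex a} {y : Vertex b} → Root x → Root y → inʳ y ~ inˡ x

⟪_⟫ : Tree → RelGraph
⟪ t ⟫ = record { V = Vertex t ; E = _~_ }

root : ∀ t → Vertex t
root •       = point
root (a ▷ b) = inʳ (root b)

root-Root : ∀ t → Root (root t)
root-Root •       = point
root-Root (a ▷ b) = inʳ (root-Root b)

Root⇒≡root : ∀ {t} {x : Vertex t} → Root x → x ≡ root t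
Root⇒≡root point   = refl
Root⇒≡root (inʳ r) = cong inʳ (Root⇒≡root r)

Root-unique : ∀ {t} {x y : Vertex t} → Root x → Root y → x ≡ y
Root-unique r s = trans (Root⇒≡root r) (sym (Root⇒≡root s))

Root? : ∀ {t} (x : Vertex t) → Dec (Root x)
Root? point   = yes point
Root? (inˡ x) = no λ ()
Root? (inʳ y) with Root? y
... | yes r = yes (inʳ r)
... | no ¬r = no λ { (inʳ r) → ¬r r }

~-sym : ∀ {t} {x y : Vertex t} → x ~ y → y ~ x
~-sym (inˡ e)  = inˡ (~-sym e)
~-sym (inʳ e)  = inʳ (~-sym e)
~-sym (lr r s) = rl r s
~-sym (rl r s) = lr r s

~-irrefl : ∀ {t} {x : Vertex t} → ¬ x ~ x
~-irrefl (inˡ e) = ~-irrefl e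
~-irrefl (inʳ e) = ~-irrefl e

_~?_ : ∀ {t} (x y : Vertex t) → Dec (x ~ y)
point ~? point = no λ ()
inˡ x ~? inˡ y with x ~? y
... | yes e = yes (inˡ e)
... | no ¬e = no λ { (inˡ e) → ¬e e }
inʳ x ~? inʳ y with x ~? y
... | yes e = yes (inʳ e)
... | no ¬e = no λ { (inʳ e) → ¬e e }
inˡ x ~? inʳ y with Root? x | Root? y
... | yes r | yes s = yes (lr r s)
... | no ¬r | _     = no λ { (lr r s) → ¬r r }
... | yes r | no ¬s = no λ { (lr r s) → ¬s s }
inʳ y ~? inˡ x with Root? x | Root? y
... | yes r | yes s = yes (rl r s)
... | no ¬r | _     = no λ { (rl r s) → ¬r r }
... | yes r | no ¬s = no λ { (rl r s) → ¬s s }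

-- Connectedness as an induction principle: `b` is filled from its root, the joining edge leads over
-- to the root of `a`, and `a` is filled from there.
Vertex-ind : ∀ {t} (P : Vertex t → Set) → (∀ {x} → Root x → P x) →
             (∀ {x y} → x ~ y → P x → P y) → ∀ x → P x
Vertex-ind P atRoot next point = atRoot point
Vertex-ind {a ▷ b} P atRoot next = λ { (inˡ x) → left x ; (inʳ y) → right y }
  where
  right : ∀ y → P (inʳ y)
  right = Vertex-ind (λ y → P (inʳ y)) (λ r → atRoot (inʳ r)) (λ e → next (inʳ e))
  left : ∀ x → P (inˡ x)
  left = Vertex-ind (λ x → P (inˡ x)) (λ r → next (rl r (root-Root b)) (right (root b)))
                    (λ e → next (inˡ e))

-- Rooted isomorphism

infix 4 _≃_

_≃_ : Tree → Tree → Set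
t ≃ u = Σ[ φ ∈ Iso ⟪ t ⟫ ⟪ u ⟫ ] (∀ {x} → Root x → Root (to φ x))

≃-at-root : ∀ {t u} (φ : Iso ⟪ t ⟫ ⟪ u ⟫) → Root (to φ (root t)) → t ≃ u
≃-at-root φ r = φ , λ s → subst (λ x → Root (to φ x)) (sym (Root⇒≡root s)) r

≃-refl : ∀ {t} → t ≃ t
≃-refl = Iso-refl , λ r → r

≃-sym : ∀ {t u} → t ≃ u → u ≃ t
≃-sym {t} {u} (φ , rooted) = Iso-sym φ , λ r →
  subst Root (trans (sym (from-to φ (root t))) (cong (from φ) (Root-unique (rooted (root-Root t)) r)))
        (root-Root t)

≃-trans : ∀ {t u v} → t ≃ u → u ≃ v → t ≃ v
≃-trans (φ , r) (ψ , s) = Iso-trans φ ψ , λ x → s (r x)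

▷-map : ∀ {a b c d} → (Vertex a → Vertex c) → (Vertex b → Vertex d) → Vertex (a ▷ b) → Vertex (c ▷ d)
▷-map f g (inˡ x) = inˡ (f x)
▷-map f g (inʳ y) = inʳ (g y)

▷-map-inverse : ∀ {a b c d} {f : Vertex a → Vertex c} {g : Vertex b → Vertex d} {f⁻ g⁻} →
                (∀ x → f (f⁻ x) ≡ x) → (∀ y → g (g⁻ y) ≡ y) →
                ∀ z → ▷-map f g (▷-map f⁻ g⁻ z) ≡ z
▷-map-inverse p q (inˡ x) = cong inˡ (p x)
▷-map-inverse p q (inʳ y) = cong inʳ (q y)

▷-map-~ : ∀ {a b c d} {f : Vertex a → Vertex c} {g : Vertex b → Vertex d} →
          (∀ {x} → Root x → Root (f x)) → (∀ {x} → Root x → Root (g x)) →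
          (∀ {x y} → x ~ y → f x ~ f y) → (∀ {x y} → x ~ y → g x ~ g y) →
          ∀ {x y} → x ~ y → ▷-map f g x ~ ▷-map f g y
▷-map-~ fr gr fe ge (inˡ e)  = inˡ (fe e)
▷-map-~ fr gr fe ge (inʳ e)  = inʳ (ge e)
▷-map-~ fr gr fe ge (lr r s) = lr (fr r) (gr s)
▷-map-~ fr gr fe ge (rl r s) = rl (fr r) (gr s)

▷-cong : ∀ {a b c d} → a ≃ c → b ≃ d → a ▷ b ≃ c ▷ d
▷-cong α@(φ , φr) β@(ψ , ψr) = record
  { to      = ▷-map (to φ) (to ψ)
  ; from    = ▷-map (from φ) (from ψ)
  ; to-from = ▷-map-inverse (to-from φ) (to-from ψ)
  ; from-to = ▷-map-inverse (from-to φ) (from-to ψ)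
  ; to-E    = ▷-map-~ φr ψr (to-E φ) (to-E ψ)
  ; from-E  = ▷-map-~ (proj₂ (≃-sym α)) (proj₂ (≃-sym β)) (from-E φ) (from-E ψ)
  } , λ { (inʳ r) → inʳ (ψr r) }

swap : ∀ {a b} → Vertex (a ▷ b) → Vertex (b ▷ a)
swap (inˡ x) = inʳ x
swap (inʳ y) = inˡ y

swap-swap : ∀ {a b} (x : Vertex (a ▷ b)) → swap (swap x) ≡ x
swap-swap (inˡ x) = refl
swap-swap (inʳ y) = refl

swap-~ : ∀ {a b} {x y : Vertex (a ▷ b)} → x ~ y → swap x ~ swap y
swap-~ (inˡ e)  = inʳ e
swap-~ (inʳ e)  = inˡ e
swap-~ (lr r s) = rl s r
swap-~ (rl r s) = lr s r

▷-comm : ∀ {a b} → Iso ⟪ a ▷ b ⟫ ⟪ b ▷ a ⟫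
▷-comm = record
  { to = swap ; from = swap ; to-from = swap-swap ; from-to = swap-swap
  ; to-E = swap-~ ; from-E = swap-~ }

exchange : ∀ {a b c} → Vertex (a ▷ b ▷ c) → Vertex (b ▷ a ▷ c)
exchange (inˡ x)       = inʳ (inˡ x)
exchange (inʳ (inˡ y)) = inˡ y
exchange (inʳ (inʳ z)) = inʳ (inʳ z)

exchange-exchange : ∀ {a b c} (x : Vertex (a ▷ b ▷ c)) → exchange (exchange x) ≡ x
exchange-exchange (inˡ x)       = refl
exchange-exchange (inʳ (inˡ y)) = refl
exchange-exchange (inʳ (inʳ z)) = refl

exchange-~ : ∀ {a b c} {x y : Vertex (a ▷ b ▷ c)} → x ~ y → exchange x ~ exchange y
exchange-~ (inˡ e)            = inʳ (inˡ e)
exchange-~ (inʳ (inˡ e))      = inˡ e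
exchange-~ (inʳ (inʳ e))      = inʳ (inʳ e)
exchange-~ (inʳ (lr r s))     = lr r (inʳ s)
exchange-~ (inʳ (rl r s))     = rl r (inʳ s)
exchange-~ (lr r (inʳ s))     = inʳ (lr r s)
exchange-~ (rl r (inʳ s))     = inʳ (rl r s)

▷-exchange : ∀ {a b c} → a ▷ b ▷ c ≃ b ▷ a ▷ c
▷-exchange = record
  { to = exchange ; from = exchange ; to-from = exchange-exchange ; from-to = exchange-exchange
  ; to-E = exchange-~ ; from-E = exchange-~ } , λ { (inʳ (inʳ r)) → inʳ (inʳ r) }

-- Branches at the root

-- These triples correspond to the edges at the root: cutting such an edge leaves the branch `c` and
-- the rest `d`, which keeps the root of `t`.
data Pick : Tree → Tree → Tree → Set where
  here  : ∀ {a b} → Pick (a ▷ b) a b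
  there : ∀ {a b c d} → Pick b c d → Pick (a ▷ b) c (a ▷ d)

Pick⇒≃ : ∀ {t c d} → Pick t c d → t ≃ c ▷ d
Pick⇒≃ here      = ≃-refl
Pick⇒≃ (there p) = ≃-trans (▷-cong ≃-refl (Pick⇒≃ p)) ▷-exchange

-- The branch comes to the front by an explicit isomorphism, because automorphisms are composed with
-- it later and the position of `x` has to be followed.
branchOf : ∀ {t} (x : Vertex t) → ¬ Root x →
           ∃₂ λ c d → Σ[ p ∈ Pick t c d ] ∃ λ y → to (proj₁ (Pick⇒≃ p)) x ≡ inˡ y
branchOf point   ¬r = ⊥-elim (¬r point)
branchOf (inˡ x) ¬r = _ , _ , here , x , refl
branchOf (inʳ x) ¬r with branchOf x (λ r → ¬r (inʳ r))
... | c , d , p , y , eq = c , _ , there p , y , cong (λ z → exchange (inʳ z)) eq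

any-Pick? : ∀ {P : Tree → Tree → Set} → (∀ c d → Dec (P c d)) → ∀ t →
            Dec (∃₂ λ c d → Pick t c d × P c d)
any-Pick? P? •       = no λ { (_ , _ , () , _) }
any-Pick? P? (a ▷ b) with P? a b
... | yes p = yes (a , b , here , p)
... | no ¬p with any-Pick? (λ c d → P? c (a ▷ d)) b
...   | yes (c , d , q , p) = yes (c , a ▷ d , there q , p)
...   | no ¬q = no λ { (_ , _ , here , p) → ¬p p ; (c , _ , there q , p) → ¬q (c , _ , q , p) }

-- Splitting an isomorphism along the joining edge

inˡ-injective : ∀ {a b} {x y : Vertex a} → inˡ {a} {b} x ≡ inˡ y → x ≡ y
inˡ-injective refl = refl

inʳ-injective : ∀ {a b} {x y : Vertex b} → inʳ {a} {b} x ≡ inʳ y → x ≡ y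
inʳ-injective refl = refl

module _ {a b c d} (φ : Iso ⟪ a ▷ b ⟫ ⟪ c ▷ d ⟫)
         {x₀ : Vertex c} (rx : Root x₀) (ex : to φ (inˡ (root a)) ≡ inˡ x₀)
         {y₀ : Vertex d} (ry : Root y₀) (ey : to φ (inʳ (root b)) ≡ inʳ y₀)
  where

  private
    -- A walk inside a ends up in d only by crossing the joining edge, whose
    -- far end is already the image of the root of b.
    left : ∀ x → ∃ λ x′ → to φ (inˡ x) ≡ inˡ x′
    left = Vertex-ind _ (λ r → x₀ , trans (cong (λ z → to φ (inˡ z)) (Root⇒≡root r)) ex) next
      where
      next : ∀ {x y} → x ~ y → (∃ λ x′ → to φ (inˡ x) ≡ inˡ x′) → ∃ λ y′ → to φ (inˡ y) ≡ inˡ y′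
      next {x} {y} e (x′ , p) with to φ (inˡ y) in q | subst₂ _~_ p refl (to-E φ (inˡ e))
      ... | inˡ y′ | _ = y′ , refl
      ... | inʳ y′ | lr _ r
        with to-injective φ (trans q (trans (cong inʳ (Root-unique r ry)) (sym ey)))
      ...   | ()

    right : ∀ y → ∃ λ y′ → to φ (inʳ y) ≡ inʳ y′
    right = Vertex-ind _ (λ r → y₀ , trans (cong (λ z → to φ (inʳ z)) (Root⇒≡root r)) ey) next
      where
      next : ∀ {x y} → x ~ y → (∃ λ x′ → to φ (inʳ x) ≡ inʳ x′) → ∃ λ y′ → to φ (inʳ y) ≡ inʳ y′
      next {x} {y} e (x′ , p) with to φ (inʳ y) in q | subst₂ _~_ p refl (to-E φ (inʳ e))
      ... | inʳ y′ | _ = y′ , refl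
      ... | inˡ y′ | rl r _
        with to-injective φ (trans q (trans (cong inˡ (Root-unique r rx)) (sym ex)))
      ...   | ()

  splitˡ : Vertex a → Vertex c
  splitˡ x = proj₁ (left x)

  splitʳ : Vertex b → Vertex d
  splitʳ y = proj₁ (right y)

  splitˡ-eq : ∀ x → to φ (inˡ x) ≡ inˡ (splitˡ x)
  splitˡ-eq x = proj₂ (left x)

  splitʳ-eq : ∀ y → to φ (inʳ y) ≡ inʳ (splitʳ y)
  splitʳ-eq y = proj₂ (right y)

inˡ-~⁻ : ∀ {a b} {x y : Vertex a} → inˡ {a} {b} x ~ inˡ y → x ~ y
inˡ-~⁻ (inˡ e) = e

inʳ-~⁻ : ∀ {a b} {x y : Vertex b} → inʳ {a} {b} x ~ inʳ y → x ~ y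
inʳ-~⁻ (inʳ e) = e

-- The joining edge is a bridge; once it goes to the joining edge, each side must stay on its side.
-- The same argument for `Iso-sym φ` supplies the inverse maps.
split : ∀ {a b c d} (φ : Iso ⟪ a ▷ b ⟫ ⟪ c ▷ d ⟫)
        {x₀ : Vertex c} → Root x₀ → to φ (inˡ (root a)) ≡ inˡ x₀ →
        {y₀ : Vertex d} → Root y₀ → to φ (inʳ (root b)) ≡ inʳ y₀ →
        Σ[ α ∈ a ≃ c ] Σ[ β ∈ b ≃ d ]
        (∀ x → to φ (inˡ x) ≡ inˡ (to (proj₁ α) x)) × (∀ y → to φ (inʳ y) ≡ inʳ (to (proj₁ β) y))
split {a} {b} {c} {d} φ rx ex ry ey =
  ≃-at-root α (subst Root (inˡ-injective (trans (sym ex) (fˡ (root a)))) rx) ,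
  ≃-at-root β (subst Root (inʳ-injective (trans (sym ey) (fʳ (root b)))) ry) ,
  fˡ , fʳ
  where
  fˡ = splitˡ-eq φ rx ex ry ey
  fʳ = splitʳ-eq φ rx ex ry ey
  ex⁻ : from φ (inˡ (root c)) ≡ inˡ (root a)
  ex⁻ = trans (cong (from φ) (trans (cong inˡ (sym (Root⇒≡root rx))) (sym ex))) (from-to φ _)
  ey⁻ : from φ (inʳ (root d)) ≡ inʳ (root b)
  ey⁻ = trans (cong (from φ) (trans (cong inʳ (sym (Root⇒≡root ry))) (sym ey))) (from-to φ _)
  gˡ = splitˡ-eq (Iso-sym φ) (root-Root a) ex⁻ (root-Root b) ey⁻
  gʳ = splitʳ-eq (Iso-sym φ) (root-Root a) ex⁻ (root-Root b) ey⁻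
  α : Iso ⟪ a ⟫ ⟪ c ⟫
  α = record
    { to      = splitˡ φ rx ex ry ey
    ; from    = splitˡ (Iso-sym φ) (root-Root a) ex⁻ (root-Root b) ey⁻
    ; to-from = λ y → inˡ-injective (trans (sym (fˡ _)) (trans (cong (to φ) (sym (gˡ y))) (to-from φ _)))
    ; from-to = λ x → inˡ-injective (trans (sym (gˡ _)) (trans (cong (from φ) (sym (fˡ x))) (from-to φ _)))
    ; to-E    = λ e → inˡ-~⁻ (subst₂ _~_ (fˡ _) (fˡ _) (to-E φ (inˡ e)))
    ; from-E  = λ e → inˡ-~⁻ (subst₂ _~_ (gˡ _) (gˡ _) (from-E φ (inˡ e)))
    }
  β : Iso ⟪ b ⟫ ⟪ d ⟫
  β = record
    { to      = splitʳ φ rx ex ry ey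
    ; from    = splitʳ (Iso-sym φ) (root-Root a) ex⁻ (root-Root b) ey⁻
    ; to-from = λ y → inʳ-injective (trans (sym (fʳ _)) (trans (cong (to φ) (sym (gʳ y))) (to-from φ _)))
    ; from-to = λ x → inʳ-injective (trans (sym (gʳ _)) (trans (cong (from φ) (sym (fʳ x))) (from-to φ _)))
    ; to-E    = λ e → inʳ-~⁻ (subst₂ _~_ (fʳ _) (fʳ _) (to-E φ (inʳ e)))
    ; from-E  = λ e → inʳ-~⁻ (subst₂ _~_ (gʳ _) (gʳ _) (from-E φ (inʳ e)))
    }

-- The root of `a` is adjacent to the root of `a ▷ b`, so its image is the root of some branch of
-- `u`. With that branch in front, `split` applies. The pointwise equations let `RRigid-▷` compute
-- `φ` itself.
match : ∀ {a b u} (φ : a ▷ b ≃ u) →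
        ∃₂ λ c d → Σ[ p ∈ Pick u c d ] Σ[ α ∈ a ≃ c ] Σ[ β ∈ b ≃ d ]
        (∀ x → to (proj₁ (Pick⇒≃ p)) (to (proj₁ φ) (inˡ x)) ≡ inˡ (to (proj₁ α) x)) ×
        (∀ y → to (proj₁ (Pick⇒≃ p)) (to (proj₁ φ) (inʳ y)) ≡ inʳ (to (proj₁ β) y))
match {a} {b} {u} (φ , φr) with branchOf (to φ (inˡ (root a))) nonroot
  where
  nonroot : ¬ Root (to φ (inˡ (root a)))
  nonroot r with to-injective φ (Root-unique r (φr (inʳ (root-Root b))))
  ... | ()
... | c , d , p , x₀ , ex with to ψ (inʳ (root b)) in ey | proj₂ (Pick⇒≃ p) (φr (inʳ (root-Root b)))
                             | subst₂ _~_ ex refl (to-E ψ (lr {a} {b} (root-Root a) (root-Root b)))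
  where ψ = Iso-trans φ (proj₁ (Pick⇒≃ p))
...   | inʳ y₀ | inʳ ry | lr rx _ =
  c , d , p , split (Iso-trans φ (proj₁ (Pick⇒≃ p))) rx ex ry ey

≃⇒Pick : ∀ {a b u} → a ▷ b ≃ u → ∃₂ λ c d → Pick u c d × a ≃ c × b ≃ d
≃⇒Pick φ with match φ
... | c , d , p , α , β , _ = c , d , p , α , β

-- The order of a tree

∣_∣ : Tree → ℕ
∣ • ∣     = 1
∣ a ▷ b ∣ = ∣ a ∣ + ∣ b ∣

0<∣_∣ : ∀ t → 0 < ∣ t ∣
0<∣ • ∣     = s≤s z≤n
0<∣ a ▷ b ∣ = ≤-trans 0<∣ a ∣ (m≤m+n ∣ a ∣ ∣ b ∣)

Vertex-▷ : ∀ {a b} → (Vertex a ⊎ Vertex b) ↔ Vertex (a ▷ b)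
Vertex-▷ = mk↔ₛ′ (λ { (inj₁ x) → inˡ x ; (inj₂ y) → inʳ y })
                 (λ { (inˡ x) → inj₁ x ; (inʳ y) → inj₂ y })
                 (λ { (inˡ x) → refl ; (inʳ y) → refl })
                 (λ { (inj₁ x) → refl ; (inj₂ y) → refl })

enumeration : ∀ t → Fin ∣ t ∣ ↔ Vertex t
enumeration •       = ↔-trans 1↔⊤ (mk↔ₛ′ (λ _ → point) (λ _ → _) (λ { point → refl }) (λ _ → refl))
enumeration (a ▷ b) = ↔-trans +↔⊎ (↔-trans (enumeration a ⊎-↔ enumeration b) Vertex-▷)

Iso⇒↔ : ∀ {X Y} → Iso X Y → V X ↔ V Y
Iso⇒↔ φ = mk↔ₛ′ (to φ) (from φ) (to-from φ) (from-to φ)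

Iso-size : ∀ {t u} → Iso ⟪ t ⟫ ⟪ u ⟫ → ∣ t ∣ ≡ ∣ u ∣
Iso-size {t} {u} φ = ↔⇒≡ (↔-trans (enumeration t) (↔-trans (Iso⇒↔ φ) (↔-sym (enumeration u))))

≃-size : ∀ {t u} → t ≃ u → ∣ t ∣ ≡ ∣ u ∣
≃-size (φ , _) = Iso-size φ

Pick-size : ∀ {t c d} → Pick t c d → ∣ t ∣ ≡ ∣ c ∣ + ∣ d ∣
Pick-size p = ≃-size (Pick⇒≃ p)

Pick-<ˡ : ∀ {t c d} → Pick t c d → ∣ c ∣ < ∣ t ∣
Pick-<ˡ {t} {c} {d} p = subst (∣ c ∣ <_) (sym (Pick-size p)) (m<m+n ∣ c ∣ 0<∣ d ∣)

-- Rigidity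

RRigid : Tree → Set
RRigid t = (φ : t ≃ t) → ∀ x → to (proj₁ φ) x ≡ x

Rigid : RelGraph → Set
Rigid X = (φ : Iso X X) → ∀ x → to φ x ≡ x

Rigid⇒RRigid : ∀ {t} → Rigid ⟪ t ⟫ → RRigid t
Rigid⇒RRigid rig (φ , _) = rig φ

conjugate-id : ∀ {X Y} (ψ : Iso X Y) (φ : Iso Y Y) →
               (∀ x → from ψ (to φ (to ψ x)) ≡ x) → ∀ y → to φ y ≡ y
conjugate-id ψ φ h y =
  trans (cong (to φ) (sym (to-from ψ y)))
        (trans (sym (to-from ψ _)) (trans (cong (to ψ) (h (from ψ y))) (to-from ψ y)))

RRigid-resp : ∀ {t u} → t ≃ u → RRigid t → RRigid u
RRigid-resp ψ rig φ = conjugate-id (proj₁ ψ) (proj₁ φ) (rig (≃-trans ψ (≃-trans φ (≃-sym ψ))))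

Rigid-resp : ∀ {X Y} → Iso X Y → Rigid X → Rigid Y
Rigid-resp ψ rig φ = conjugate-id ψ φ (rig (Iso-trans ψ (Iso-trans φ (Iso-sym ψ))))

-- An automorphism takes the branch `a` either to itself, and then fixes both sides, or to a branch
-- of `b`, which `sep` excludes.
RRigid-▷ : ∀ {a b} → RRigid a → RRigid b → (∀ {c d} → Pick b c d → ¬ a ≃ c) → RRigid (a ▷ b)
RRigid-▷ ra rb sep φ x with match φ
RRigid-▷ ra rb sep φ (inˡ x) | _ , _ , here , α , β , eα , eβ = trans (eα x) (cong inˡ (ra α x))
RRigid-▷ ra rb sep φ (inʳ y) | _ , _ , here , α , β , eα , eβ = trans (eβ y) (cong inʳ (rb β y))
... | _ , _ , there p , α , _ = ⊥-elim (sep p α)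

RRigid-▷ˡ : ∀ {a b} → RRigid (a ▷ b) → RRigid a
RRigid-▷ˡ rig φ x = inˡ-injective (rig (▷-cong φ ≃-refl) (inˡ x))

RRigid-▷ʳ : ∀ {a b} → RRigid (a ▷ b) → RRigid b
RRigid-▷ʳ rig φ y = inʳ-injective (rig (▷-cong ≃-refl φ) (inʳ y))

-- Isomorphic branches could be interchanged, and the interchange moves the root of `a`.
RRigid-▷-distinct : ∀ {a b} → RRigid (a ▷ b) → ∀ {c d} → Pick b c d → ¬ a ≃ c
RRigid-▷-distinct {a} {b} rig {c} {d} p f
  with RRigid-resp (▷-cong ≃-refl (Pick⇒≃ p)) rig
         (≃-trans ▷-exchange (▷-cong (≃-sym f) (▷-cong f ≃-refl))) (inˡ (root a))
... | ()

-- Otherwise the tree has a reflection that reverses the joining edge.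
Rigid⇒sides-distinct : ∀ {a b} → Rigid ⟪ a ▷ b ⟫ → ¬ a ≃ b
Rigid⇒sides-distinct {a} rig f
  with rig (Iso-trans ▷-comm (proj₁ (▷-cong (≃-sym f) f))) (inˡ (root a))
... | ()

-- The root is a centroid.
Balanced : Tree → Set
Balanced t = ∀ {c d} → Pick t c d → ∣ c ∣ ≤ ∣ d ∣

-- Isomorphic sides have equal order, which makes both ends of the edge centroids. What is forbidden
-- is thus the reflection exchanging two centroids.
Asymmetric : Tree → Set
Asymmetric t = ∀ {c d} → Pick t c d → ¬ c ≃ d

Balanced-resp : ∀ {t u} → t ≃ u → Balanced t → Balanced u
Balanced-resp φ bal p with ≃⇒Pick (≃-trans (≃-sym (Pick⇒≃ p)) (≃-sym φ))
... | _ , _ , q , α , β = subst₂ _≤_ (sym (≃-size α)) (sym (≃-size β)) (bal q)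

Rigid⇒Asymmetric : ∀ {t} → Rigid ⟪ t ⟫ → Asymmetric t
Rigid⇒Asymmetric rig p = Rigid⇒sides-distinct (Rigid-resp (proj₁ (Pick⇒≃ p)) rig)

-- Moving the root of e ▷ c into c makes the branch e grow.
reroot : ∀ n e c → ∣ c ∣ ≤ n → (y : Vertex c) →
         Root y ⊎ (∃₂ λ e′ g → Σ[ φ ∈ Iso ⟪ e ▷ c ⟫ ⟪ e′ ▷ g ⟫ ]
                   Root (to φ (inʳ y)) × ∣ e ∣ < ∣ e′ ∣)
reroot n e c bound y with Root? y
... | yes r = inj₁ r
... | no ¬r with branchOf y ¬r
reroot zero    e c bound y | no _ | _ , _ , p , _ = ⊥-elim (n≮0 (≤-trans 0<∣ c ∣ bound))
-- The root enters the branch `c₁`, and everything else hangs from it as the single branch `e ▷ c₂`.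
reroot (suc n) e c bound y | no _ | c₁ , c₂ , p , y₁ , eq
  with reroot n (e ▷ c₂) c₁ (≤-pred (≤-trans (Pick-<ˡ p) bound)) y₁
... | inj₁ r = inj₂ (e ▷ c₂ , c₁ , ψ , subst Root (cong (λ z → swap (exchange (inʳ z))) (sym eq)) (inʳ r)
                    , m<m+n ∣ e ∣ 0<∣ c₂ ∣)
  where ψ = Iso-trans (proj₁ (≃-trans (▷-cong ≃-refl (Pick⇒≃ p)) ▷-exchange)) ▷-comm
... | inj₂ (e′ , g , φ , r , lt) =
  inj₂ (e′ , g , Iso-trans ψ φ
       , subst Root (cong (λ z → to φ (swap (exchange (inʳ z)))) (sym eq)) r
       , <-trans (m<m+n ∣ e ∣ 0<∣ c₂ ∣) lt)
  where ψ = Iso-trans (proj₁ (≃-trans (▷-cong ≃-refl (Pick⇒≃ p)) ▷-exchange)) ▷-comm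

-- An automorphism moving the root moves it to the other centroid, a neighbour, and
-- thereby exchanges two isomorphic halves.
Rigid-intro : ∀ {t} → Balanced t → Asymmetric t → RRigid t → Rigid ⟪ t ⟫
Rigid-intro {t} bal asym rig σ with Root? (to σ (root t))
... | yes r = rig (≃-at-root σ r)
... | no ¬r with branchOf (to σ (root t)) ¬r
... | c , d , p , y , eq with reroot ∣ c ∣ d c ≤-refl y
... | inj₁ r = ⊥-elim (mirror (≃⇒Pick (≃-trans (≃-sym (Pick⇒≃ p)) τ)))
  where
  τ : t ≃ d ▷ c
  τ = ≃-at-root (Iso-trans σ (Iso-trans (proj₁ (Pick⇒≃ p)) ▷-comm)) (subst Root (cong swap (sym eq)) (inʳ r))
  -- Seen from the new root, the branch `c` of `t` corresponds to `d` or to a branch of `c` itself,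
  -- which is too small.
  mirror : ¬ ∃₂ λ c₁ d₁ → Pick (d ▷ c) c₁ d₁ × c ≃ c₁ × d ≃ d₁
  mirror (_ , _ , here , α , _) = asym p α
  mirror (_ , _ , there q , α , _) = <⇒≱ (Pick-<ˡ q) (subst (∣ c ∣ ≤_) (≃-size α) ≤-refl)
-- The image of the root lies deeper than a neighbour. Balance at the new root gives
-- `∣ c ∣ ≤ ∣ d ∣ < ∣ e ∣ ≤ ∣ g ∣`, although both pairs have the same sum.
... | inj₂ (e , g , φ , r , d<e) = ⊥-elim (<-irrefl total (+-mono-≤-< c≤d′ d<g))
  where
  ψ : Iso ⟪ t ⟫ ⟪ d ▷ c ⟫
  ψ = Iso-trans (proj₁ (Pick⇒≃ p)) ▷-comm
  τ : t ≃ e ▷ g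
  τ = ≃-at-root (Iso-trans σ (Iso-trans ψ φ)) (subst Root (cong (λ z → to φ (swap z)) (sym eq)) r)
  e≤g : ∣ e ∣ ≤ ∣ g ∣
  e≤g = Balanced-resp τ bal here
  c≤d′ : ∣ c ∣ ≤ ∣ e ∣
  c≤d′ = ≤-trans (bal p) (<⇒≤ d<e)
  d<g : ∣ d ∣ < ∣ g ∣
  d<g = ≤-trans d<e e≤g
  total : ∣ c ∣ + ∣ d ∣ ≡ ∣ e ∣ + ∣ g ∣
  total = trans (sym (Pick-size p)) (≃-size τ)

-- The walk to a centroid: while some branch of `c` outweighs all the rest, the root steps into it.
-- The part `d` left behind is always the lighter side, so only branches ahead are tested.
recentre : ∀ n d c → ∣ c ∣ ≤ n → ∣ d ∣ ≤ ∣ c ∣ → ∃ λ t → Iso ⟪ d ▷ c ⟫ ⟪ t ⟫ × Balanced t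
recentre n d c bound d≤c with any-Pick? (λ c₁ c₂ → ∣ d ▷ c₂ ∣ <? ∣ c₁ ∣) c
... | no ¬p = d ▷ c , Iso-refl , λ { here → d≤c ; (there q) → ≮⇒≥ λ lt → ¬p (_ , _ , q , lt) }
recentre zero    d c bound d≤c | yes (c₁ , c₂ , p , lt) = ⊥-elim (n≮0 (≤-trans 0<∣ c ∣ bound))
recentre (suc n) d c bound d≤c | yes (c₁ , c₂ , p , lt)
  with recentre n (d ▷ c₂) c₁ (≤-pred (≤-trans (Pick-<ˡ p) bound)) (<⇒≤ lt)
... | t , φ , bal =
  t , Iso-trans (Iso-trans (proj₁ (≃-trans (▷-cong ≃-refl (Pick⇒≃ p)) ▷-exchange)) ▷-comm) φ , bal

centroid : ∀ t → ∃ λ u → Iso ⟪ t ⟫ ⟪ u ⟫ × Balanced u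
centroid •       = • , Iso-refl , λ ()
centroid (a ▷ b) with ≤-total ∣ a ∣ ∣ b ∣
... | inj₁ a≤b = recentre ∣ b ∣ a b ≤-refl a≤b
... | inj₂ b≤a with recentre ∣ a ∣ b a ≤-refl b≤a
...   | u , φ , bal = u , Iso-trans ▷-comm φ , bal

size-1⇒• : ∀ {t} → ∣ t ∣ ≤ 1 → t ≡ •
size-1⇒• {•}     _ = refl
size-1⇒• {a ▷ b} h = ⊥-elim (<⇒≱ (+-mono-≤ 0<∣ a ∣ 0<∣ b ∣) h)

smaller⇒≄ : ∀ {t u} → ∣ t ∣ < ∣ u ∣ → ¬ t ≃ u
smaller⇒≄ lt f = <⇒≢ lt (≃-size f)

larger⇒≄ : ∀ {t u} → ∣ u ∣ < ∣ t ∣ → ¬ t ≃ u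
larger⇒≄ lt f = <⇒≢ lt (sym (≃-size f))

-- Decidability permits the later case distinctions on whether pruning creates a symmetry.
_≃?_ : ∀ t u → Dec (t ≃ u)
•       ≃? •       = yes ≃-refl
•       ≃? (a ▷ b) = no (smaller⇒≄ (+-mono-≤ 0<∣ a ∣ 0<∣ b ∣))
(a ▷ b) ≃? u with any-Pick? (λ c d → (a ≃? c) ×-dec (b ≃? d)) u
... | yes (_ , _ , p , α , β) = yes (≃-trans (▷-cong α β) (≃-sym (Pick⇒≃ p)))
... | no ¬p = no λ f → ¬p (≃⇒Pick f)

-- Adjoining a leaf

graft : ∀ t → Vertex t → Tree
graft •       point   = • ▷ •
graft (a ▷ b) (inˡ v) = graft a v ▷ b
graft (a ▷ b) (inʳ v) = a ▷ graft b v

graft-size : ∀ t v → ∣ graft t v ∣ ≡ suc ∣ t ∣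
graft-size •       point   = refl
graft-size (a ▷ b) (inˡ v) = cong (_+ ∣ b ∣) (graft-size a v)
graft-size (a ▷ b) (inʳ v) = trans (cong (∣ a ∣ +_) (graft-size b v)) (+-suc ∣ a ∣ ∣ b ∣)

infix 4 _⋖_ _◁_

-- This relation keeps the root and so lifts through branches by `⋖-▷`; `◁` forgets the root, as
-- re-rooting at a centroid demands.
_⋖_ : Tree → Tree → Set
t ⋖ u = ∃ λ v → graft t v ≃ u

_◁_ : Tree → Tree → Set
t ◁ u = ∃ λ v → Iso ⟪ graft t v ⟫ ⟪ u ⟫

⋖⇒◁ : ∀ {t u} → t ⋖ u → t ◁ u
⋖⇒◁ (v , φ , _) = v , φ

◁-resp : ∀ {t u w} → Iso ⟪ u ⟫ ⟪ w ⟫ → t ◁ u → t ◁ w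
◁-resp φ (v , ψ) = v , Iso-trans ψ φ

⋖-resp : ∀ {t u w} → u ≃ w → t ⋖ u → t ⋖ w
⋖-resp φ (v , ψ) = v , ≃-trans ψ φ

⋖-▷ : ∀ {a a′ b} → a′ ⋖ a → a′ ▷ b ⋖ a ▷ b
⋖-▷ (v , φ) = inˡ v , ▷-cong φ ≃-refl

⋖-leaf : ∀ t → t ⋖ • ▷ t
⋖-leaf t = root t , graft-root t
  where
  graft-root : ∀ t → graft t (root t) ≃ • ▷ t
  graft-root •       = ≃-refl
  graft-root (a ▷ b) = ≃-trans (▷-cong ≃-refl (graft-root b)) ▷-exchange

⋖-size : ∀ {t u} → t ⋖ u → ∣ u ∣ ≡ suc ∣ t ∣
⋖-size {t} (v , φ) = trans (sym (≃-size φ)) (graft-size t v)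

⋖-< : ∀ {t u} → t ⋖ u → ∣ t ∣ < ∣ u ∣
⋖-< l = ≤-reflexive (sym (⋖-size l))

•⋖⇒≃ : ∀ {t} → • ⋖ t → • ▷ • ≃ t
•⋖⇒≃ (point , φ) = φ

smallest-branch : ∀ a b → ∃₂ λ c d → Pick (a ▷ b) c d × (∀ {e f} → Pick (a ▷ b) e f → ∣ c ∣ ≤ ∣ e ∣)
smallest-branch a • = a , • , here , λ { here → ≤-refl }
smallest-branch a (b₁ ▷ b₂) with smallest-branch b₁ b₂
... | c , d , p , min with ≤-total ∣ a ∣ ∣ c ∣
...   | inj₁ a≤c = a , b₁ ▷ b₂ , here , λ { here → ≤-refl ; (there q) → ≤-trans a≤c (min q) }
...   | inj₂ c≤a = c , a ▷ d , there p , λ { here → c≤a ; (there q) → min q }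

smallest-resp : ∀ {t u n} → t ≃ u → (∀ {e f} → Pick t e f → n ≤ ∣ e ∣) → ∀ {e f} → Pick u e f → n ≤ ∣ e ∣
smallest-resp φ min q with ≃⇒Pick (≃-trans (≃-sym (Pick⇒≃ q)) (≃-sym φ))
... | _ , _ , p , α , _ = ≤-trans (min p) (≤-reflexive (sym (≃-size α)))

-- Pruning a smallest branch makes it strictly smaller than its siblings, so the
-- branches remain pairwise non-isomorphic.
prune′ : ∀ n t → ∣ t ∣ ≤ n → 1 < ∣ t ∣ → RRigid t → ∃ λ t′ → t′ ⋖ t × RRigid t′
prune′ n      •       bound (s≤s ()) rig
prune′ zero   (a ▷ b) bound nontriv  rig = ⊥-elim (n≮0 (≤-trans nontriv bound))
prune′ (suc n) (a ▷ b) bound nontriv  rig with smallest-branch a b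
... | c , d , p , min = go (1 <? ∣ c ∣)
  where
  rig′ : RRigid (c ▷ d)
  rig′ = RRigid-resp (Pick⇒≃ p) rig
  go : Dec (1 < ∣ c ∣) → ∃ λ t′ → t′ ⋖ a ▷ b × RRigid t′
  -- A branch consisting of one vertex is itself the leaf to remove.
  go (no c≯1) with size-1⇒• {c} (≮⇒≥ c≯1)
  ... | refl = d , ⋖-resp (≃-sym (Pick⇒≃ p)) (⋖-leaf d) , RRigid-▷ʳ rig′
  go (yes 1<c) with prune′ n c (≤-pred (≤-trans (Pick-<ˡ p) bound)) 1<c (RRigid-▷ˡ rig′)
  ... | c′ , l , rc′ =
    c′ ▷ d , ⋖-resp (≃-sym (Pick⇒≃ p)) (⋖-▷ l) ,
    RRigid-▷ rc′ (RRigid-▷ʳ rig′)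
      (λ q → smaller⇒≄ (≤-trans (⋖-< l) (smallest-resp (Pick⇒≃ p) min (there q))))

prune : ∀ {t} → 1 < ∣ t ∣ → RRigid t → ∃ λ t′ → t′ ⋖ t × RRigid t′
prune {t} = prune′ ∣ t ∣ t ≤-refl

-- `x ▷ •` is `x` planted on a new root. That root has one branch, so the last leaf either is this
-- branch or lies inside it; a leaf grafted in the root part beside an existing branch would leave
-- more than the bare root there.
⋖-stem : ∀ {u x} → u ⋖ x ▷ • → x ≡ • ⊎ ∃ λ y → y ⋖ x × u ≃ y ▷ •
⋖-stem {•} (point , φ) with ≃⇒Pick φ
... | _ , _ , here , α , _ = inj₁ (size-1⇒• (≤-reflexive (sym (≃-size α))))
⋖-stem {c ▷ d} (inˡ v , φ) with ≃⇒Pick φ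
... | _ , _ , here , α , β = inj₂ (c , (v , α) , ▷-cong ≃-refl β)
⋖-stem {c ▷ d} (inʳ v , φ) with ≃⇒Pick φ
... | _ , _ , here , _ , β =
  ⊥-elim (larger⇒≄ (subst (1 <_) (sym (graft-size d v)) (s≤s 0<∣ d ∣)) β)

-- The hypotheses are inherited by b′ and b″ ▷ •, where b″ ⋖ b′; the descent ends
-- only when a and b are both paths.
twins : ∀ n {a b a′ b′} → ∣ a ∣ ≤ n → a′ ⋖ a → b′ ⋖ b → b ≃ a′ ▷ • → a ≃ b′ ▷ • → a ≃ b
twins zero    {a} bound _ _ _ _ = ⊥-elim (n≮0 (≤-trans 0<∣ a ∣ bound))
twins (suc n) {a} {b} {a′} {b′} bound la lb eb ea with ⋖-stem (⋖-resp ea la)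
... | inj₁ refl = ≃-trans ea (•⋖⇒≃ lb)
... | inj₂ (b″ , l , ea′) with ⋖-stem (⋖-resp (≃-trans eb (▷-cong ea′ ≃-refl)) lb)
...   | inj₂ (y , l′ , eb′) =
  ≃-trans ea (≃-trans (▷-cong (≃-trans (twins n bound′ l l′ ≃-refl eb′) (≃-sym ea′)) ≃-refl) (≃-sym eb))
  where
  bound′ : ∣ b′ ∣ ≤ n
  bound′ = ≤-pred (≤-trans (subst (∣ b′ ∣ <_) (sym (≃-size ea)) (m<m+n ∣ b′ ∣ (s≤s z≤n))) bound)

-- Choosing the leaf

-- `Balanced` and `Asymmetric` together: with `RRigid`, what `Rigid-intro` asks of the pruned tree.
Centred : Tree → Set
Centred t = ∀ {c d} → Pick t c d → ∣ c ∣ ≤ ∣ d ∣ × ¬ c ≃ d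

lighter : ∀ {c d} → ∣ c ∣ < ∣ d ∣ → ∣ c ∣ ≤ ∣ d ∣ × ¬ c ≃ d
lighter lt = <⇒≤ lt , smaller⇒≄ lt

Reducible : Tree → Set
Reducible t = ∃ λ t′ → t′ ◁ t × RRigid t′ × Centred t′

Reducible-resp : ∀ {t u} → Iso ⟪ t ⟫ ⟪ u ⟫ → Reducible t → Reducible u
Reducible-resp φ (t′ , l , r , c) = t′ , ◁-resp φ l , r , c

-- Two centroids: a tree with halves of equal order

module _ {a b} (a≄b : ¬ a ≃ b) (ra : RRigid a) (rb : RRigid b) (a≡b : ∣ a ∣ ≡ ∣ b ∣) where

  private
    nontrivial : 1 < ∣ a ∣
    nontrivial = ≰⇒> λ a≤1 → a≄b (subst₂ _≃_ (sym (size-1⇒• a≤1))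
                                   (sym (size-1⇒• (≤-trans (≤-reflexive (sym a≡b)) a≤1))) ≃-refl)

  -- After pruning, the root of `b` is the only centroid of `a′ ▷ b`, so only a branch of `b`
  -- isomorphic to `a′` can obstruct.
  prune-half : ∃ λ a′ → a′ ⋖ a × (Reducible (a ▷ b) ⊎ b ≃ a′ ▷ •)
  prune-half with prune nontrivial ra
  ... | a′ , l , ra′ = a′ , l , go (any-Pick? (λ c _ → a′ ≃? c) b)
    where
    b-size : ∣ b ∣ ≡ suc ∣ a′ ∣
    b-size = trans (sym a≡b) (⋖-size l)
    centred : Centred (a′ ▷ b)
    centred here = lighter (subst (∣ a′ ∣ <_) a≡b (⋖-< l))
    centred (there {d = d} q) =
      lighter (≤-<-trans (≤-pred (subst (_ <_) b-size (Pick-<ˡ q))) (m<m+n ∣ a′ ∣ 0<∣ d ∣))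
    go : Dec (∃₂ λ c d → Pick b c d × a′ ≃ c) → Reducible (a ▷ b) ⊎ b ≃ a′ ▷ •
    go (no ¬p) = inj₁ (a′ ▷ b , ⋖⇒◁ (⋖-▷ l) , RRigid-▷ ra′ rb (λ q f → ¬p (_ , _ , q , f)) , centred)
    -- Since `b` has one vertex more than `a′`, only the root of `b` remains outside the branch.
    go (yes (c , d , p , f)) with size-1⇒• {d} (+-cancelˡ-≤ ∣ c ∣ _ _ (≤-reflexive
        (trans (sym (Pick-size p)) (trans b-size (trans (cong suc (≃-size f)) (+-comm 1 ∣ c ∣))))))
    ... | refl = inj₂ (≃-trans (Pick⇒≃ p) (▷-cong (≃-sym f) ≃-refl))

reduce-halves : ∀ {a b} → ¬ a ≃ b → RRigid a → RRigid b → ∣ a ∣ ≡ ∣ b ∣ → Reducible (a ▷ b)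
reduce-halves {a} a≄b ra rb a≡b
  with prune-half a≄b ra rb a≡b | prune-half (λ f → a≄b (≃-sym f)) rb ra (sym a≡b)
... | _ , _ , inj₁ red | _ = red
... | _ , _ , inj₂ _ | _ , _ , inj₁ red = Reducible-resp ▷-comm red
... | _ , la , inj₂ eb | _ , lb , inj₂ ea = ⊥-elim (a≄b (twins ∣ a ∣ ≤-refl la lb eb ea))


-- One centroid: the exceptional coincidences

RRigid-exchange : ∀ {a b c} → RRigid (a ▷ b ▷ c) → RRigid (b ▷ a ▷ c)
RRigid-exchange = RRigid-resp ▷-exchange

-- Here `a` and `c` have equal order. Once `c` is pruned, `a` holds exactly half of the tree; were
-- it isomorphic to the rest `c′ ▷ •`, `twins` would give `a ≃ c`.
reduce-two-branches : ∀ {a a′ c} → RRigid (a ▷ c ▷ •) → a′ ⋖ a → c ≃ a′ ▷ • → Reducible (a ▷ c ▷ •)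
reduce-two-branches {a} {a′} {c} rig l f
  with prune (subst (1 <_) (sym (≃-size f)) (m<n+m 1 0<∣ a′ ∣)) (RRigid-▷ˡ (RRigid-▷ʳ rig))
... | c′ , l′ , rc′ =
  c′ ▷ a ▷ • , ⋖⇒◁ (⋖-resp ▷-exchange (⋖-▷ l′)) ,
  RRigid-▷ rc′ (RRigid-▷ʳ (RRigid-exchange rig)) (λ { here → smaller⇒≄ c′<a ; (there ()) }) ,
  λ { here → lighter (≤-trans c′<a (m≤m+n ∣ a ∣ 1))
    ; (there here) → ≤-reflexive a-size ,
        λ g → RRigid-▷-distinct rig here (twins ∣ a ∣ ≤-refl l l′ f g)
    ; (there (there ())) }
  where
  a-size : ∣ a ∣ ≡ ∣ c′ ∣ + 1
  a-size = trans (trans (⋖-size l) (+-comm 1 ∣ a′ ∣)) (trans (sym (≃-size f)) (trans (⋖-size l′) (+-comm 1 ∣ c′ ∣)))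
  c′<a : ∣ c′ ∣ < ∣ a ∣
  c′<a = subst (∣ c′ ∣ <_) (sym a-size) (m<m+n ∣ c′ ∣ (s≤s z≤n))

-- `c′` has two vertices fewer than `a ▷ d`, hence less than half of the tree, but at least as many
-- as `d` because `a` has at least two. It therefore still exceeds every other branch.
reduce-big-sibling : ∀ {a a′ c d} → RRigid (a ▷ c ▷ d) → 1 < ∣ a ∣ → ∣ a ∣ < ∣ d ∣ →
                     a′ ⋖ a → c ≃ a′ ▷ d → Reducible (a ▷ c ▷ d)
reduce-big-sibling {a} {a′} {c} {d} rig 1<a a<d l f
  with prune (subst (1 <_) (sym (≃-size f)) (+-mono-≤ 0<∣ a′ ∣ 0<∣ d ∣)) (RRigid-▷ˡ (RRigid-▷ʳ rig))
... | c′ , l′ , rc′ =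
  c′ ▷ a ▷ d , ⋖⇒◁ (⋖-resp ▷-exchange (⋖-▷ l′)) ,
  RRigid-▷ rc′ (RRigid-▷ʳ (RRigid-exchange rig))
    (λ { here → larger⇒≄ (≤-trans a<d d≤c′) ; (there q) → larger⇒≄ (≤-trans (Pick-<ˡ q) d≤c′) }) ,
  λ { here → lighter (subst (∣ c′ ∣ <_) c′-size (m<n+m ∣ c′ ∣ {2} (s≤s z≤n)))
    ; (there here) → lighter (≤-trans a<d (m≤n+m ∣ d ∣ ∣ c′ ∣))
    ; (there (there q)) → lighter (≤-trans (Pick-<ˡ q) (≤-trans d≤c′ (m≤m+n ∣ c′ ∣ _))) }
  where
  c′-size : suc (suc ∣ c′ ∣) ≡ ∣ a ∣ + ∣ d ∣
  c′-size = trans (cong suc (trans (sym (⋖-size l′)) (≃-size f))) (cong (_+ ∣ d ∣) (sym (⋖-size l)))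
  d≤c′ : ∣ d ∣ ≤ ∣ c′ ∣
  d≤c′ = +-cancelˡ-≤ 2 _ _ (subst (2 + ∣ d ∣ ≤_) (sym c′-size) (+-monoˡ-≤ ∣ d ∣ 1<a))

-- Beside the removed branch there remain the root and another branch.
Pick-of-two-rest : ∀ {a b c u w} → Pick (a ▷ b ▷ c) u w → 1 < ∣ w ∣
Pick-of-two-rest {a} {b} {c} here              = +-mono-≤ 0<∣ b ∣ 0<∣ c ∣
Pick-of-two-rest {a}         (there {d = d} q) = +-mono-≤ 0<∣ a ∣ 0<∣ d ∣

-- As `d` has at least two branches, each has at most `∣ d ∣ - 2` vertices. The pruned `c` has
-- `∣ d ∣ - 1` and stays strictly the largest branch.
reduce-leaf-bushy : ∀ {c d₁ d₂ d₃} → let d = d₁ ▷ d₂ ▷ d₃ in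
                    RRigid (• ▷ c ▷ d) → c ≃ d → Reducible (• ▷ c ▷ d)
reduce-leaf-bushy {c} {d₁} {d₂} {d₃} rig f
  with prune (subst (1 <_) (sym (≃-size f)) (<⇒≤ 2<d)) (RRigid-▷ˡ (RRigid-▷ʳ rig))
  where
  2<d : 2 < ∣ d₁ ▷ d₂ ▷ d₃ ∣
  2<d = +-mono-≤ 0<∣ d₁ ∣ (+-mono-≤ 0<∣ d₂ ∣ 0<∣ d₃ ∣)
... | c′ , l , rc′ =
  c′ ▷ • ▷ d , ⋖⇒◁ (⋖-resp ▷-exchange (⋖-▷ l)) ,
  RRigid-▷ rc′ (RRigid-▷ʳ (RRigid-exchange rig))
    (λ { here → larger⇒≄ 1<c′ ; (there q) → larger⇒≄ (branch<c′ q) }) ,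
  λ { here → lighter (≤-trans (⋖-< l) (≤-trans (≤-reflexive (≃-size f)) (n≤1+n ∣ d ∣)))
    ; (there here) → lighter (≤-trans 1<c′ (m≤m+n ∣ c′ ∣ ∣ d ∣))
    ; (there (there q)) → lighter (≤-trans (branch<c′ q) (m≤m+n ∣ c′ ∣ _)) }
  where
  d = d₁ ▷ d₂ ▷ d₃
  d-size : ∣ d ∣ ≡ suc ∣ c′ ∣
  d-size = trans (sym (≃-size f)) (⋖-size l)
  1<c′ : 1 < ∣ c′ ∣
  1<c′ = ≤-pred (subst (2 <_) d-size (+-mono-≤ 0<∣ d₁ ∣ (+-mono-≤ 0<∣ d₂ ∣ 0<∣ d₃ ∣)))
  branch<c′ : ∀ {u w} → Pick d u w → ∣ u ∣ < ∣ c′ ∣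
  branch<c′ {u} {w} q = ≤-pred (subst₂ _≤_ (+-comm ∣ u ∣ 2) (trans (sym (Pick-size q)) d-size)
                                  (+-monoʳ-≤ ∣ u ∣ (Pick-of-two-rest q)))

-- The final operand `(• ▷ •) ▷ •` is the centre carrying the leg `• ▷ •`, so the legs have 1, 3 and
-- 2 vertices in this order.
E7-tree : Tree
E7-tree = • ▷ ((• ▷ •) ▷ •) ▷ ((• ▷ •) ▷ •)

-- The branches are `•`, `c` and the middle one, `e`. Pruning `e` makes `c` exactly half of the
-- tree, but `c` has one branch at its root and the other half has two. Only `e′ = •` collides with
-- the leaf, and then all three legs are determined.
reduce-leaf-stem : ∀ {c e} → let t = • ▷ c ▷ e ▷ • in
                   RRigid t → c ≃ e ▷ • → E7-tree ≃ t ⊎ Reducible t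
reduce-leaf-stem {c} {e} rig f with prune 1<e (RRigid-▷ˡ (RRigid-▷ʳ (RRigid-▷ʳ rig)))
  where
  1<e : 1 < ∣ e ∣
  1<e = ≰⇒> λ e≤1 → RRigid-▷-distinct rig (there here) (subst (• ≃_) (sym (size-1⇒• e≤1)) ≃-refl)
... | e′ , l , re′ with 1 <? ∣ e′ ∣
... | yes 1<e′ = inj₂
  ( e′ ▷ • ▷ c ▷ •
  , ⋖⇒◁ (⋖-resp (≃-trans ▷-exchange (▷-cong ≃-refl ▷-exchange)) (⋖-▷ l))
  , RRigid-▷ re′ (RRigid-▷ʳ (RRigid-exchange rig′))
      (λ { here → larger⇒≄ 1<e′ ; (there here) → smaller⇒≄ e′<c ; (there (there ())) })
  , λ { here → lighter (≤-trans e′<c (≤-trans (m≤m+n ∣ c ∣ 1) (n≤1+n _)))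
      ; (there here) → lighter (≤-trans 1<e′ (m≤m+n ∣ e′ ∣ _))
      ; (there (there here)) → ≤-reflexive c-size , λ g → no-match (≃⇒Pick (≃-trans (≃-sym f) g))
      ; (there (there (there ()))) } )
  where
  rig′ : RRigid (• ▷ e ▷ c ▷ •)
  rig′ = RRigid-resp (▷-cong ≃-refl ▷-exchange) rig
  c-size : ∣ c ∣ ≡ ∣ e′ ∣ + 2
  c-size = trans (≃-size f) (trans (cong (_+ 1) (⋖-size l)) (sym (+-suc ∣ e′ ∣ 1)))
  e′<c : ∣ e′ ∣ < ∣ c ∣
  e′<c = subst (∣ e′ ∣ <_) (sym c-size) (m<m+n ∣ e′ ∣ (s≤s z≤n))
  no-match : ¬ ∃₂ λ u w → Pick (e′ ▷ • ▷ •) u w × e ≃ u × • ≃ w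
  no-match (_ , _ , here , _ , β) = smaller⇒≄ (s≤s (s≤s z≤n)) β
  no-match (_ , _ , there here , _ , β) = smaller⇒≄ (m<n+m 1 0<∣ e′ ∣) β
... | no e′≯1 with size-1⇒• {e′} (≮⇒≥ e′≯1)
...   | refl = inj₁ (▷-cong ≃-refl (▷-cong (≃-trans stem (≃-sym f)) stem))
  where
  stem : (• ▷ •) ▷ • ≃ e ▷ •
  stem = ▷-cong (•⋖⇒≃ l) ≃-refl

-- The root is the only centroid.
Strict : Tree → Set
Strict t = ∀ {c d} → Pick t c d → ∣ c ∣ < ∣ d ∣

Strict-resp : ∀ {t u} → t ≃ u → Strict t → Strict u
Strict-resp φ strict p with ≃⇒Pick (≃-trans (≃-sym (Pick⇒≃ p)) (≃-sym φ))
... | _ , _ , q , α , β = subst₂ _<_ (sym (≃-size α)) (sym (≃-size β)) (strict q)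

E7-or-Reducible-resp : ∀ {t u} → t ≃ u → E7-tree ≃ t ⊎ Reducible t → E7-tree ≃ u ⊎ Reducible u
E7-or-Reducible-resp φ (inj₁ f) = inj₁ (≃-trans f φ)
E7-or-Reducible-resp φ (inj₂ r) = inj₂ (Reducible-resp (proj₁ φ) r)

-- Removing the leaf would leave isomorphic halves, so another branch is pruned, depending on how
-- many branches `d` has. With none, `c` would be a second leaf at the root.
reduce-leaf-twins : ∀ {c d} → RRigid (• ▷ c ▷ d) → c ≃ d →
                    E7-tree ≃ • ▷ c ▷ d ⊎ Reducible (• ▷ c ▷ d)
reduce-leaf-twins {d = •}              rig f = ⊥-elim (RRigid-▷-distinct rig here (≃-sym f))
reduce-leaf-twins {d = e ▷ •}          rig f = reduce-leaf-stem rig f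
reduce-leaf-twins {d = d₁ ▷ d₂ ▷ d₃}   rig f = inj₂ (reduce-leaf-bushy rig f)

-- Strictness has one vertex of slack, so the root remains a centroid without the leaf; only a pair
-- of isomorphic halves can obstruct.
reduce-leaf : ∀ {r} → RRigid (• ▷ r) → Strict (• ▷ r) → E7-tree ≃ • ▷ r ⊎ Reducible (• ▷ r)
reduce-leaf {r} rig strict with any-Pick? (λ c d → c ≃? d) r
... | no ¬p = inj₂ (r , ⋖⇒◁ (⋖-leaf r) , RRigid-▷ʳ rig ,
                    λ q → ≤-pred (strict (there q)) , λ f → ¬p (_ , _ , q , f))
... | yes (c , d , p , f) =
  E7-or-Reducible-resp (≃-sym φ) (reduce-leaf-twins (RRigid-resp φ rig) f)
  where φ = ▷-cong ≃-refl (Pick⇒≃ p)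

-- Either `d` is a bare root, or it contains a branch at least as large as `a` and its own root as
-- well.
reduce-twins : ∀ {a a′ c d} → RRigid (a ▷ c ▷ d) → 1 < ∣ a ∣ → (∀ {e f} → Pick d e f → ∣ a ∣ ≤ ∣ e ∣) →
               a′ ⋖ a → c ≃ a′ ▷ d → Reducible (a ▷ c ▷ d)
reduce-twins {d = •}       rig 1<a min l f = reduce-two-branches rig l f
reduce-twins {d = d₁ ▷ d₂} rig 1<a min l f =
  reduce-big-sibling rig 1<a (≤-<-trans (min here) (m<m+n ∣ d₁ ∣ 0<∣ d₂ ∣)) l f

-- The slack of one vertex again keeps the root a centroid. The obstruction is a branch `c` that
-- becomes half of the tree and is isomorphic to the other half `a′ ▷ d`.
reduce-smallest : ∀ {a r} → RRigid (a ▷ r) → Strict (a ▷ r) → 1 < ∣ a ∣ →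
                  (∀ {e f} → Pick r e f → ∣ a ∣ ≤ ∣ e ∣) → Reducible (a ▷ r)
reduce-smallest {a} {r} rig strict 1<a min with prune 1<a (RRigid-▷ˡ rig)
... | a′ , l , ra′ with any-Pick? (λ c d → c ≃? (a′ ▷ d)) r
... | no ¬p =
  a′ ▷ r , ⋖⇒◁ (⋖-▷ l) ,
  RRigid-▷ ra′ (RRigid-▷ʳ rig) (λ q → smaller⇒≄ (≤-trans (⋖-< l) (min q))) ,
  λ { here → lighter (<-trans (⋖-< l) (strict here))
    ; (there {d = d} q) →
        ≤-pred (subst (λ n → _ < n + ∣ d ∣) (⋖-size l) (strict (there q))) , λ f → ¬p (_ , _ , q , f) }
... | yes (c , d , p , f) =
  Reducible-resp (proj₁ (≃-sym φ))
    (reduce-twins (RRigid-resp φ rig) 1<a (λ q → smallest-resp (Pick⇒≃ p) min (there q)) l f)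
  where φ = ▷-cong ≃-refl (Pick⇒≃ p)

reduce-strict : ∀ {a b} → RRigid (a ▷ b) → Strict (a ▷ b) → E7-tree ≃ a ▷ b ⊎ Reducible (a ▷ b)
reduce-strict {a} {b} rig strict with smallest-branch a b
... | c , d , p , min = E7-or-Reducible-resp (≃-sym φ) (go (1 <? ∣ c ∣))
  where
  φ = Pick⇒≃ p
  go : Dec (1 < ∣ c ∣) → E7-tree ≃ c ▷ d ⊎ Reducible (c ▷ d)
  go (yes 1<c) = inj₂ (reduce-smallest (RRigid-resp φ rig) (Strict-resp φ strict) 1<c
                        (λ q → smallest-resp φ min (there q)))
  go (no c≯1) with size-1⇒• {c} (≮⇒≥ c≯1)
  ... | refl = reduce-leaf (RRigid-resp φ rig) (Strict-resp φ strict)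

-- A branch with exactly half of the vertices signals a second centroid; without one the root is the
-- only centroid.
reduce : ∀ {a b} → RRigid (a ▷ b) → Centred (a ▷ b) → E7-tree ≃ a ▷ b ⊎ Reducible (a ▷ b)
reduce {a} {b} rig cen with any-Pick? (λ c d → ∣ c ∣ ≟ ∣ d ∣) (a ▷ b)
... | no ¬p = reduce-strict rig λ q → ≤∧≢⇒< (proj₁ (cen q)) λ eq → ¬p (_ , _ , q , eq)
... | yes (c , d , p , eq) = inj₂ (Reducible-resp (proj₁ (≃-sym φ))
    (reduce-halves (proj₂ (cen p)) (RRigid-▷ˡ rig′) (RRigid-▷ʳ rig′) eq))
  where
  φ = Pick⇒≃ p
  rig′ = RRigid-resp φ rig

-- Reducing an unrooted tree

Rigid-reduce : ∀ {t} → 1 < ∣ t ∣ → Rigid ⟪ t ⟫ →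
               Iso ⟪ E7-tree ⟫ ⟪ t ⟫ ⊎ ∃ λ t′ → t′ ◁ t × Rigid ⟪ t′ ⟫
Rigid-reduce {t} 1<t rig with centroid t
... | •     , φ , _   = ⊥-elim (<⇒≢ 1<t (sym (Iso-size φ)))
... | a ▷ b , φ , bal with reduce (Rigid⇒RRigid rig′) (λ p → bal p , Rigid⇒Asymmetric rig′ p)
  where rig′ = Rigid-resp φ rig
...   | inj₁ (ψ , _) = inj₁ (Iso-trans ψ (Iso-sym φ))
...   | inj₂ (t′ , l , r , cen) =
  inj₂ (t′ , ◁-resp (Iso-sym φ) l , Rigid-intro (λ p → proj₁ (cen p)) (λ p → proj₂ (cen p)) r)

-- Graphs with a Boolean adjacency matrix

⟦_⟧ : Graph → RelGraph
⟦ G ⟧ = record { V = Fin (size G) ; E = λ u v → adj G u v ≡ true }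

≅⇒Iso : ∀ {G H} → G ≅ H → Iso ⟦ G ⟧ ⟦ H ⟧
≅⇒Iso {G} {H} (f , f-adj) = record
  { to      = Inverse.to f
  ; from    = Inverse.from f
  ; to-from = Inverse.strictlyInverseˡ f
  ; from-to = Inverse.strictlyInverseʳ f
  ; to-E    = trans (f-adj _ _)
  ; from-E  = λ {y} {y′} e → trans (sym (f-adj _ _))
      (trans (cong₂ (adj H) (Inverse.strictlyInverseˡ f y) (Inverse.strictlyInverseˡ f y′)) e)
  }

Iso⇒≅ : ∀ {G H} → Iso ⟦ G ⟧ ⟦ H ⟧ → G ≅ H
Iso⇒≅ {G} φ = Iso⇒↔ φ , λ u v →
  ⇔→≡ (mk⇔ (λ e → subst₂ (λ x y → adj G x y ≡ true) (from-to φ u) (from-to φ v) (from-E φ e)) (to-E φ))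

Rigid⇒automorphisms-trivial : ∀ {G} → Rigid ⟦ G ⟧ → (σ : Automorphism G) → ∀ v → Inverse.to (proj₁ σ) v ≡ v
Rigid⇒automorphisms-trivial {G} rig σ = rig (≅⇒Iso {G} {G} σ)

automorphisms-trivial⇒Rigid : ∀ {G} → ((σ : Automorphism G) → ∀ v → Inverse.to (proj₁ σ) v ≡ v) → Rigid ⟦ G ⟧
automorphisms-trivial⇒Rigid {G} triv φ = triv (Iso⇒≅ {G} {G} φ)

does-true⁻ : ∀ {A : Set} (a? : Dec A) → does a? ≡ true → A
does-true⁻ (yes a) _ = a

⌊⌋-true : ∀ {A : Set} (a? : Dec A) → A → ⌊ a? ⌋ ≡ true
⌊⌋-true (yes _) _ = refl
⌊⌋-true (no ¬a) a = ⊥-elim (¬a a)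

⌊⌋-true⁻ : ∀ {A : Set} (a? : Dec A) → ⌊ a? ⌋ ≡ true → A
⌊⌋-true⁻ (yes a) _ = a

graph : Tree → Graph
graph t = record
  { size    = ∣ t ∣
  ; adj     = λ i j → does (Inverse.to f i ~? Inverse.to f j)
  ; adj-sym = λ i j → does-⇔ (mk⇔ ~-sym ~-sym) (Inverse.to f i ~? Inverse.to f j) (Inverse.to f j ~? Inverse.to f i)
  ; irrefl  = λ v → dec-false (Inverse.to f v ~? Inverse.to f v) ~-irrefl
  }
  where f = enumeration t

graph-Iso : ∀ t → Iso ⟦ graph t ⟧ ⟪ t ⟫
graph-Iso t = record
  { to      = Inverse.to f
  ; from    = Inverse.from f
  ; to-from = Inverse.strictlyInverseˡ f
  ; from-to = Inverse.strictlyInverseʳ f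
  ; to-E    = does-true⁻ (_ ~? _)
  ; from-E  = λ e → dec-true (_ ~? _)
      (subst₂ _~_ (sym (Inverse.strictlyInverseˡ f _)) (sym (Inverse.strictlyInverseˡ f _)) e)
  }
  where f = enumeration t

E7-Iso : Iso ⟦ E7 ⟧ ⟪ E7-tree ⟫
E7-Iso = record
  { to      = f
  ; from    = g
  ; to-from = f-g
  ; from-to = toWitness {a? = all? λ i → g (f i) ≟ᶠ i} tt
  ; to-E    = λ {i} {j} e → does-true⁻ (f i ~? f j) (trans (sym (table i j)) e)
  ; from-E  = λ {x} {y} e → trans (table (g x) (g y))
      (dec-true (_ ~? _) (subst₂ _~_ (sym (f-g x)) (sym (f-g y)) e))
  }
  where
  f : Fin 7 → Vertex E7-tree
  f zero                                     = inʳ (inʳ (inʳ point))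
  f (suc zero)                               = inˡ point
  f (suc (suc zero))                         = inʳ (inʳ (inˡ (inʳ point)))
  f (suc (suc (suc zero)))                   = inʳ (inʳ (inˡ (inˡ point)))
  f (suc (suc (suc (suc zero))))             = inʳ (inˡ (inʳ point))
  f (suc (suc (suc (suc (suc zero)))))       = inʳ (inˡ (inˡ (inʳ point)))
  f (suc (suc (suc (suc (suc (suc zero)))))) = inʳ (inˡ (inˡ (inˡ point)))
  g : Vertex E7-tree → Fin 7
  g (inʳ (inʳ (inʳ point)))       = zero
  g (inˡ point)                   = suc zero
  g (inʳ (inʳ (inˡ (inʳ point)))) = suc (suc zero)
  g (inʳ (inʳ (inˡ (inˡ point)))) = suc (suc (suc zero))
  g (inʳ (inˡ (inʳ point)))       = suc (suc (suc (suc zero)))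
  g (inʳ (inˡ (inˡ (inʳ point)))) = suc (suc (suc (suc (suc zero))))
  g (inʳ (inˡ (inˡ (inˡ point)))) = suc (suc (suc (suc (suc (suc zero)))))
  f-g : ∀ x → f (g x) ≡ x
  f-g (inʳ (inʳ (inʳ point)))       = refl
  f-g (inˡ point)                   = refl
  f-g (inʳ (inʳ (inˡ (inʳ point)))) = refl
  f-g (inʳ (inʳ (inˡ (inˡ point)))) = refl
  f-g (inʳ (inˡ (inʳ point)))       = refl
  f-g (inʳ (inˡ (inˡ (inʳ point)))) = refl
  f-g (inʳ (inˡ (inˡ (inˡ point)))) = refl
  table : ∀ i j → adj E7 i j ≡ does (f i ~? f j)
  -- All 49 entries of the adjacency matrix are compared by evaluation.
  table = toWitness {a? = all? λ i → all? λ j → adj E7 i j ≟ᵇ does (f i ~? f j)} tt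

-- Adjoining a leaf to a graph, compared with grafting

data PlusE {X : RelGraph} (v : V X) : Maybe (V X) → Maybe (V X) → Set where
  old     : ∀ {x y} → E X x y → PlusE v (just x) (just y)
  leaf-to : ∀ {x} → x ≡ v → PlusE v nothing (just x)
  to-leaf : ∀ {x} → x ≡ v → PlusE v (just x) nothing

-- With `nothing` as the new leaf, this is the common form through which `addLeaf` on graphs and
-- `graft` on trees are compared.
plus : (X : RelGraph) → V X → RelGraph
plus X v = record { V = Maybe (V X) ; E = PlusE {X} v }

plus-cong : ∀ {X Y v w} (φ : Iso X Y) → to φ v ≡ w → Iso (plus X v) (plus Y w)
plus-cong φ p = record
  { to      = Maybe.map (to φ)
  ; from    = Maybe.map (from φ)
  ; to-from = λ { (just y) → cong just (to-from φ y) ; nothing → refl }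
  ; from-to = λ { (just x) → cong just (from-to φ x) ; nothing → refl }
  ; to-E    = λ { (old e) → old (to-E φ e)
                ; (leaf-to q) → leaf-to (trans (cong (to φ) q) p)
                ; (to-leaf q) → to-leaf (trans (cong (to φ) q) p) }
  ; from-E  = λ { (old e) → old (from-E φ e)
                ; (leaf-to q) → leaf-to (back q)
                ; (to-leaf q) → to-leaf (back q) }
  }
  where
  back : ∀ {y} → y ≡ _ → from φ y ≡ _
  back q = trans (cong (from φ) (trans q (sym p))) (from-to φ _)

addLeaf-Iso : ∀ G v → Iso ⟦ addLeaf G v ⟧ (plus ⟦ G ⟧ v)
addLeaf-Iso G v = record
  { to      = λ { zero → nothing ; (suc i) → just i }
  ; from    = λ { nothing → zero ; (just i) → suc i }
  ; to-from = λ { nothing → refl ; (just i) → refl }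
  ; from-to = λ { zero → refl ; (suc i) → refl }
  ; to-E    = λ { {zero} {suc j} e → leaf-to (⌊⌋-true⁻ (j ≟ᶠ v) e)
                ; {suc i} {zero} e → to-leaf (⌊⌋-true⁻ (i ≟ᶠ v) e)
                ; {suc i} {suc j} e → old e }
  ; from-E  = λ { (old e) → e
                ; (leaf-to {j} q) → ⌊⌋-true (j ≟ᶠ v) q
                ; (to-leaf {i} q) → ⌊⌋-true (i ≟ᶠ v) q }
  }

graft-to : ∀ t v → Maybe (Vertex t) → Vertex (graft t v)
graft-to •       point   nothing        = inˡ point
graft-to •       point   (just point)   = inʳ point
graft-to (a ▷ b) (inˡ v) nothing        = inˡ (graft-to a v nothing)
graft-to (a ▷ b) (inˡ v) (just (inˡ x)) = inˡ (graft-to a v (just x))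
graft-to (a ▷ b) (inˡ v) (just (inʳ y)) = inʳ y
graft-to (a ▷ b) (inʳ v) nothing        = inʳ (graft-to b v nothing)
graft-to (a ▷ b) (inʳ v) (just (inˡ x)) = inˡ x
graft-to (a ▷ b) (inʳ v) (just (inʳ y)) = inʳ (graft-to b v (just y))

graft-from : ∀ t v → Vertex (graft t v) → Maybe (Vertex t)
graft-from •       point   (inˡ point) = nothing
graft-from •       point   (inʳ point) = just point
graft-from (a ▷ b) (inˡ v) (inˡ x)     = Maybe.map inˡ (graft-from a v x)
graft-from (a ▷ b) (inˡ v) (inʳ y)     = just (inʳ y)
graft-from (a ▷ b) (inʳ v) (inˡ x)     = just (inˡ x)
graft-from (a ▷ b) (inʳ v) (inʳ y)     = Maybe.map inʳ (graft-from b v y)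

graft-to-from : ∀ t v x → graft-to t v (graft-from t v x) ≡ x
graft-to-from •       point   (inˡ point) = refl
graft-to-from •       point   (inʳ point) = refl
graft-to-from (a ▷ b) (inˡ v) (inʳ y)     = refl
graft-to-from (a ▷ b) (inʳ v) (inˡ x)     = refl
graft-to-from (a ▷ b) (inˡ v) (inˡ x) with graft-from a v x | graft-to-from a v x
... | just _  | eq = cong inˡ eq
... | nothing | eq = cong inˡ eq
graft-to-from (a ▷ b) (inʳ v) (inʳ y) with graft-from b v y | graft-to-from b v y
... | just _  | eq = cong inʳ eq
... | nothing | eq = cong inʳ eq

graft-from-to : ∀ t v x → graft-from t v (graft-to t v x) ≡ x
graft-from-to •       point   nothing        = refl
graft-from-to •       point   (just point)   = refl
graft-from-to (a ▷ b) (inˡ v) nothing        = cong (Maybe.map inˡ) (graft-from-to a v nothing)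
graft-from-to (a ▷ b) (inˡ v) (just (inˡ x)) = cong (Maybe.map inˡ) (graft-from-to a v (just x))
graft-from-to (a ▷ b) (inˡ v) (just (inʳ y)) = refl
graft-from-to (a ▷ b) (inʳ v) nothing        = cong (Maybe.map inʳ) (graft-from-to b v nothing)
graft-from-to (a ▷ b) (inʳ v) (just (inˡ x)) = refl
graft-from-to (a ▷ b) (inʳ v) (just (inʳ y)) = cong (Maybe.map inʳ) (graft-from-to b v (just y))

graft-to-Root : ∀ t v {x} → Root x → Root (graft-to t v (just x))
graft-to-Root •       point   point   = inʳ point
graft-to-Root (a ▷ b) (inˡ v) (inʳ r) = inʳ r
graft-to-Root (a ▷ b) (inʳ v) (inʳ r) = inʳ (graft-to-Root b v r)

graft-to-~ : ∀ t v {x y} → PlusE {⟪ t ⟫} v x y → graft-to t v x ~ graft-to t v y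
graft-to-~ •       point   (leaf-to {point} _)     = lr point point
graft-to-~ •       point   (to-leaf {point} _)     = rl point point
graft-to-~ (a ▷ b) (inˡ v) (leaf-to refl)          = inˡ (graft-to-~ a v (leaf-to refl))
graft-to-~ (a ▷ b) (inˡ v) (to-leaf refl)          = inˡ (graft-to-~ a v (to-leaf refl))
graft-to-~ (a ▷ b) (inʳ v) (leaf-to refl)          = inʳ (graft-to-~ b v (leaf-to refl))
graft-to-~ (a ▷ b) (inʳ v) (to-leaf refl)          = inʳ (graft-to-~ b v (to-leaf refl))
graft-to-~ (a ▷ b) (inˡ v) (old (inˡ e))           = inˡ (graft-to-~ a v (old e))
graft-to-~ (a ▷ b) (inˡ v) (old (inʳ e))           = inʳ e
graft-to-~ (a ▷ b) (inˡ v) (old (lr r s))          = lr (graft-to-Root a v r) s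
graft-to-~ (a ▷ b) (inˡ v) (old (rl r s))          = rl (graft-to-Root a v r) s
graft-to-~ (a ▷ b) (inʳ v) (old (inˡ e))           = inˡ e
graft-to-~ (a ▷ b) (inʳ v) (old (inʳ e))           = inʳ (graft-to-~ b v (old e))
graft-to-~ (a ▷ b) (inʳ v) (old (lr r s))          = lr r (graft-to-Root b v s)
graft-to-~ (a ▷ b) (inʳ v) (old (rl r s))          = rl r (graft-to-Root b v s)

-- The new leaf is never the root, so a joining edge after grafting comes from an old joining edge.
graft-from-Root : ∀ t v {x} → Root x → ∃ λ y → graft-from t v x ≡ just y × Root y
graft-from-Root •       point   (inʳ point) = point , refl , point
graft-from-Root (a ▷ b) (inˡ v) (inʳ r)     = _ , refl , inʳ r
graft-from-Root (a ▷ b) (inʳ v) (inʳ r) with graft-from-Root b v r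
... | y , eq , s = inʳ y , cong (Maybe.map inʳ) eq , inʳ s

PlusE-inˡ : ∀ {a b v x y} → PlusE {⟪ a ⟫} v x y →
            PlusE {⟪ a ▷ b ⟫} (inˡ v) (Maybe.map inˡ x) (Maybe.map inˡ y)
PlusE-inˡ (old e)        = old (inˡ e)
PlusE-inˡ (leaf-to refl) = leaf-to refl
PlusE-inˡ (to-leaf refl) = to-leaf refl

PlusE-inʳ : ∀ {a b v x y} → PlusE {⟪ b ⟫} v x y →
            PlusE {⟪ a ▷ b ⟫} (inʳ v) (Maybe.map inʳ x) (Maybe.map inʳ y)
PlusE-inʳ (old e)        = old (inʳ e)
PlusE-inʳ (leaf-to refl) = leaf-to refl
PlusE-inʳ (to-leaf refl) = to-leaf refl

graft-from-~ : ∀ t v {x y} → x ~ y → PlusE {⟪ t ⟫} v (graft-from t v x) (graft-from t v y)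
graft-from-~ •       point   (lr point point) = leaf-to refl
graft-from-~ •       point   (rl point point) = to-leaf refl
graft-from-~ (a ▷ b) (inˡ v) (inˡ e)          = PlusE-inˡ (graft-from-~ a v e)
graft-from-~ (a ▷ b) (inˡ v) (inʳ e)          = old (inʳ e)
graft-from-~ (a ▷ b) (inʳ v) (inˡ e)          = old (inˡ e)
graft-from-~ (a ▷ b) (inʳ v) (inʳ e)          = PlusE-inʳ (graft-from-~ b v e)
graft-from-~ (a ▷ b) (inˡ v) (lr {x = x} r s) with graft-from a v x | graft-from-Root a v r
... | _ | _ , refl , r′ = old (lr r′ s)
graft-from-~ (a ▷ b) (inˡ v) (rl {x = x} r s) with graft-from a v x | graft-from-Root a v r
... | _ | _ , refl , r′ = old (rl r′ s)
graft-from-~ (a ▷ b) (inʳ v) (lr {y = y} r s) with graft-from b v y | graft-from-Root b v s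
... | _ | _ , refl , s′ = old (lr r s′)
graft-from-~ (a ▷ b) (inʳ v) (rl {y = y} r s) with graft-from b v y | graft-from-Root b v s
... | _ | _ , refl , s′ = old (rl r s′)

graft-Iso : ∀ t v → Iso (plus ⟪ t ⟫ v) ⟪ graft t v ⟫
graft-Iso t v = record
  { to      = graft-to t v
  ; from    = graft-from t v
  ; to-from = graft-to-from t v
  ; from-to = graft-from-to t v
  ; to-E    = graft-to-~ t v
  ; from-E  = graft-from-~ t v
  }

-- The preceding graph may be taken to be `graph t′`, since `step` compares the enlarged graph with
-- `G` only up to isomorphism.
build : ∀ n t → ∣ t ∣ ≤ n → 1 < ∣ t ∣ → Rigid ⟪ t ⟫ → ∀ G → Iso ⟦ G ⟧ ⟪ t ⟫ → 2 ≤ size G → Buildable G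
build zero    t bound 1<t rig G γ 2≤G = ⊥-elim (n≮0 (≤-trans 1<t bound))
build (suc n) t bound 1<t rig G γ 2≤G with Rigid-reduce 1<t rig
... | inj₁ φ = base (Iso⇒≅ {E7} {G} (Iso-trans E7-Iso (Iso-trans φ (Iso-sym γ))))
... | inj₂ (t′ , (v , φ) , rig′) =
  step (build n t′ (≤-pred (subst (_≤ suc n) t-size bound)) 1<t′ rig′ (graph t′) (graph-Iso t′) 1<t′)
       (from (graph-Iso t′) v)
       (Iso⇒≅ {addLeaf (graph t′) (from (graph-Iso t′) v)} {G}
          (Iso-trans (addLeaf-Iso (graph t′) _)
            (Iso-trans (plus-cong (graph-Iso t′) (to-from (graph-Iso t′) v))
              (Iso-trans (graft-Iso t′ v) (Iso-trans φ (Iso-sym γ))))))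
       (2≤G , Rigid⇒automorphisms-trivial {G} (Rigid-resp (Iso-sym γ) rig))
  where
  t-size : ∣ t ∣ ≡ suc ∣ t′ ∣
  t-size = trans (sym (Iso-size φ)) (graft-size t′ v)
  -- The descent never reaches a single vertex: the edge before it has a reflection.
  edge-not-rigid : ∀ v → Rigid ⟪ graft • v ⟫ → ⊥
  edge-not-rigid point r = Rigid⇒sides-distinct r ≃-refl
  not-a-point : t′ ≡ • → ⊥
  not-a-point refl = edge-not-rigid v (Rigid-resp (Iso-sym φ) rig)
  1<t′ : 1 < ∣ t′ ∣
  1<t′ = ≰⇒> λ t′≤1 → not-a-point (size-1⇒• t′≤1)

-- Every tree graph has this form

lookup-injective : ∀ {A : Set} {xs : List A} → Unique xs → ∀ {i j} → lookup xs i ≡ lookup xs j → i ≡ j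
lookup-injective (x≢ ∷ u) {zero}  {zero}  eq = refl
lookup-injective (x≢ ∷ u) {zero}  {suc j} eq = ⊥-elim (All.lookup x≢ (∈-lookup j) eq)
lookup-injective (x≢ ∷ u) {suc i} {zero}  eq = ⊥-elim (All.lookup x≢ (∈-lookup i) (sym eq))
lookup-injective (x≢ ∷ u) {suc i} {suc j} eq = cong suc (lookup-injective u eq)

Unique⇒length≤ : ∀ {n} {xs : List (Fin n)} → Unique xs → length xs ≤ n
Unique⇒length≤ u = injective⇒≤ (lookup-injective u)

adj⇒≢ : ∀ (G : Graph) {u v} → adj G u v ≡ true → ¬ u ≡ v
adj⇒≢ G {u} e refl with trans (sym e) (irrefl G u)
... | ()

-- The path is cut just after `z`, whence the `suc`, and closed by the edge from `z` to `x`.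
Chain-close : ∀ G {x w l z} → Chain G (w ∷ l) → (p : z ∈ l) → adj G z x ≡ true →
              Chain G (w ∷ take (suc (toℕ (index p))) l ++ [ x ])
Chain-close G (e , ch) (here refl)           f = e , f , tt
Chain-close G (e , ch) (there {xs = _ ∷ _} p) f = e , Chain-close G ch p f

cycle : ∀ G {x y l z} → Unique (x ∷ y ∷ l) → Chain G (x ∷ y ∷ l) → z ∈ l → adj G z x ≡ true → HasCycle G
cycle G {x} {y} {l} u ch p f =
  x , take (suc (toℕ (index (there {x = y} p)))) (y ∷ l) , take⁺ _ u , long p , Chain-close G ch (there p) f
  where
  -- Since `z` comes after `y`, both are kept besides `x`, which makes three vertices.
  long : ∀ {z l} (p : z ∈ l) → 2 ≤ length (take (suc (toℕ (index (there {x = y} p)))) (y ∷ l))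
  long (here _)  = s≤s (s≤s z≤n)
  long (there _) = s≤s (s≤s z≤n)

IsLeaf : (G : Graph) → Fin (size G) → Fin (size G) → Set
IsLeaf G ℓ p = adj G ℓ p ≡ true × (∀ z → adj G ℓ z ≡ true → z ≡ p)

-- The path is prolonged at its front end; by acyclicity it never meets itself.
find-leaf : ∀ G → ¬ HasCycle G → ∀ k {x y l} → Unique (x ∷ y ∷ l) → Chain G (x ∷ y ∷ l) →
            size G < k + length (x ∷ y ∷ l) → ∃₂ (IsLeaf G)
find-leaf G acyclic zero    u ch bound = ⊥-elim (<⇒≱ bound (Unique⇒length≤ u))
find-leaf G acyclic (suc k) {x} {y} {l} u ch@(e , _) bound
  with any? (λ z → (adj G x z ≟ᵇ true) ×-dec ¬? (z ≟ᶠ y))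
... | no ¬p = x , y , e , λ z f → decidable-stable (z ≟ᶠ y) λ z≢y → ¬p (z , f , z≢y)
... | yes (z , f , z≢y) with DecMembership._∈?_ _≟ᶠ_ z l
...   | yes z∈l = ⊥-elim (acyclic (cycle G u ch z∈l (trans (adj-sym G z x) f)))
...   | no z∉l = find-leaf G acyclic k
  (((λ z≡x → adj⇒≢ G f (sym z≡x)) ∷ z≢y ∷ ¬Any⇒All¬ l z∉l) ∷ u)
  (trans (adj-sym G z x) f , ch)
  (subst (size G <_) (sym (+-suc k _)) bound)

leaf-exists : ∀ G → IsTree G → 2 ≤ size G → ∃₂ (IsLeaf G)
leaf-exists record { size = suc zero } _ (s≤s ())
leaf-exists G@(record { size = suc (suc m) }) (conn , acyclic) _ with conn zero (suc zero)
-- The first edge of a walk between distinct vertices starts the path. Its two vertices and the fuel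
-- `suc m` exceed the order of `G` by one.
... | there e _ = find-leaf G acyclic (suc m) ((adj⇒≢ G e ∷ []) ∷ [] ∷ []) (e , tt)
                    (≤-reflexive (sym (cong suc (+-comm m 2))))

-- An arbitrary injection `ι` whose image is everything but `ℓ` keeps the arithmetic of `punchIn`
-- out of the arguments.
module Deletion (G : Graph) {m} (ι : Fin m → Fin (size G)) (ι-injective : ∀ {i j} → ι i ≡ ι j → i ≡ j)
                {ℓ p} (leaf : IsLeaf G ℓ p) (avoids : ∀ i → ¬ ι i ≡ ℓ) (ι⁻¹ : ∀ z → ¬ z ≡ ℓ → ∃ λ i → ι i ≡ z)
  where

  deleted : Graph
  deleted = record
    { size    = m
    ; adj     = λ i j → adj G (ι i) (ι j)
    ; adj-sym = λ i j → adj-sym G (ι i) (ι j)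
    ; irrefl  = λ i → irrefl G (ι i)
    }

  private
    p≢ℓ : ¬ p ≡ ℓ
    p≢ℓ p≡ℓ = adj⇒≢ G (proj₁ leaf) (sym p≡ℓ)

  p′ : Fin m
  p′ = proj₁ (ι⁻¹ p p≢ℓ)

  ι-p′ : ι p′ ≡ p
  ι-p′ = proj₂ (ι⁻¹ p p≢ℓ)

  private
    -- A walk enters and leaves ℓ through p, so visits to ℓ can be cut out.
    restrict : ∀ {u v} → Reach G u v → ∀ {j} → ι j ≡ v →
               (∀ i → ι i ≡ u → Reach deleted i j) × (u ≡ ℓ → Reach deleted p′ j)
    restrict here {j} ej =
      (λ i ei → subst (λ k → Reach deleted k j) (ι-injective (trans ej (sym ei))) here) ,
      (λ u≡ℓ → ⊥-elim (avoids j (trans ej u≡ℓ)))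
    restrict (there {u} {w} e r) {j} ej with restrict r ej | w ≟ᶠ ℓ
    ... | _ , from-ℓ | yes refl =
      (λ i ei → subst (λ k → Reach deleted k j)
                  (ι-injective (trans ι-p′ (sym (trans ei (proj₂ leaf u (trans (adj-sym G ℓ u) e))))))
                  (from-ℓ refl)) ,
      (λ u≡ℓ → ⊥-elim (adj⇒≢ G e u≡ℓ))
    ... | from-ι , _ | no w≢ℓ with ι⁻¹ w w≢ℓ
    ...   | k , refl =
      (λ i ei → there (subst (λ z → adj G z (ι k) ≡ true) (sym ei) e) (from-ι k refl)) ,
      (λ u≡ℓ → from-ι p′ (trans ι-p′ (sym (proj₂ leaf (ι k) (subst (λ z → adj G z (ι k) ≡ true) u≡ℓ e)))))

    Chain-ι : ∀ l → Chain deleted l → Chain G (map ι l)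
    Chain-ι []           _        = tt
    Chain-ι (_ ∷ [])     _        = tt
    Chain-ι (_ ∷ y ∷ l) (e , ch) = e , Chain-ι (y ∷ l) ch

  deleted-IsTree : IsTree G → IsTree deleted
  deleted-IsTree (conn , acyclic) =
    (λ i j → proj₁ (restrict (conn (ι i) (ι j)) refl) i refl) ,
    λ { (x , xs , u , long , ch) → acyclic
          ( ι x , map ι xs , map⁺ ι-injective u , subst (2 ≤_) (sym (length-map ι xs)) long
          , subst (λ l → Chain G (ι x ∷ l)) (map-++ ι xs [ x ]) (Chain-ι _ ch)) }

  deleted-Iso : Iso (plus ⟦ deleted ⟧ p′) ⟦ G ⟧
  deleted-Iso = record
    { to      = f
    -- The decision is an argument of `g`, so that `f-g` and `g-E` can match on it.
    ; from    = λ z → g z (z ≟ᶠ ℓ)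
    ; to-from = λ z → f-g z (z ≟ᶠ ℓ)
    ; from-to = λ x → f-injective (f-g (f x) (f x ≟ᶠ ℓ))
    ; to-E    = λ { (old e) → e
                  ; (leaf-to refl) → subst (λ z → adj G ℓ z ≡ true) (sym ι-p′) (proj₁ leaf)
                  ; (to-leaf refl) → trans (adj-sym G _ ℓ)
                                       (subst (λ z → adj G ℓ z ≡ true) (sym ι-p′) (proj₁ leaf)) }
    ; from-E  = λ {y} {y′} e → g-E (y ≟ᶠ ℓ) (y′ ≟ᶠ ℓ) e
    }
    where
    f : Maybe (Fin m) → Fin (size G)
    f nothing  = ℓ
    f (just i) = ι i
    g : ∀ z → Dec (z ≡ ℓ) → Maybe (Fin m)
    g z (yes _)  = nothing
    g z (no z≢ℓ) = just (proj₁ (ι⁻¹ z z≢ℓ))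
    f-g : ∀ z d → f (g z d) ≡ z
    f-g z (yes z≡ℓ) = sym z≡ℓ
    f-g z (no z≢ℓ)  = proj₂ (ι⁻¹ z z≢ℓ)
    f-injective : ∀ {x y} → f x ≡ f y → x ≡ y
    f-injective {nothing} {nothing} _  = refl
    f-injective {nothing} {just j}  eq = ⊥-elim (avoids j (sym eq))
    f-injective {just i}  {nothing} eq = ⊥-elim (avoids i eq)
    f-injective {just i}  {just j}  eq = cong just (ι-injective eq)
    neighbour : ∀ {z} (z≢ℓ : ¬ z ≡ ℓ) → adj G ℓ z ≡ true → proj₁ (ι⁻¹ z z≢ℓ) ≡ p′
    neighbour z≢ℓ e = ι-injective (trans (proj₂ (ι⁻¹ _ z≢ℓ)) (trans (proj₂ leaf _ e) (sym ι-p′)))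
    g-E : ∀ {y y′} (d : Dec (y ≡ ℓ)) (d′ : Dec (y′ ≡ ℓ)) → adj G y y′ ≡ true →
          PlusE {⟦ deleted ⟧} p′ (g y d) (g y′ d′)
    g-E (yes refl) (yes refl) e = ⊥-elim (adj⇒≢ G e refl)
    g-E (yes refl) (no n′)    e = leaf-to (neighbour n′ e)
    g-E (no n)     (yes refl) e = to-leaf (neighbour n (trans (adj-sym G _ _) e))
    g-E (no n)     (no n′)    e =
      old (subst₂ (λ a b → adj G a b ≡ true) (sym (proj₂ (ι⁻¹ _ n))) (sym (proj₂ (ι⁻¹ _ n′))) e)

delete-leaf : ∀ G → IsTree G → ∀ {ℓ p} → IsLeaf G ℓ p →
              ∃ λ G′ → IsTree G′ × suc (size G′) ≡ size G × ∃ λ v → Iso (plus ⟦ G′ ⟧ v) ⟦ G ⟧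
delete-leaf G@(record { size = suc m }) tree {ℓ} leaf =
  deleted , deleted-IsTree tree , refl , p′ , deleted-Iso
  where
  open Deletion G (punchIn ℓ) (punchIn-injective ℓ _ _) leaf (punchInᵢ≢i ℓ)
         (λ z z≢ℓ → punchOut (λ ℓ≡z → z≢ℓ (sym ℓ≡z)) , punchIn-punchOut _)

single-vertex : ∀ G → size G ≡ 1 → Iso ⟦ G ⟧ ⟪ • ⟫
single-vertex G@(record { size = suc zero }) refl = record
  { to = λ _ → point ; from = λ _ → zero ; to-from = λ { point → refl } ; from-to = λ { zero → refl }
  ; to-E = λ { {zero} {zero} e → ⊥-elim (adj⇒≢ G e refl) } ; from-E = λ () }

-- By induction on the order: a leaf is deleted, the remaining tree is represented, and the leaf is
-- grafted back at its neighbour.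
tree-of : ∀ n G → size G ≡ suc n → IsTree G → ∃ λ t → Iso ⟦ G ⟧ ⟪ t ⟫
tree-of zero    G eq tree = • , single-vertex G eq
tree-of (suc n) G eq tree with leaf-exists G tree (subst (2 ≤_) (sym eq) (s≤s (s≤s z≤n)))
... | ℓ , p , leaf with delete-leaf G tree leaf
... | G′ , tree′ , eq′ , v , φ with tree-of n G′ (suc-injective (trans eq′ eq)) tree′
... | t , ψ = graft t (to ψ v) , Iso-trans (Iso-sym φ) (Iso-trans (plus-cong ψ refl) (graft-Iso t (to ψ v)))

theorem1p2 : (T : Graph) → IsTree T → AutFree T → Buildable T
theorem1p2 T tree (2≤T , triv) with tree-of (pred (size T)) T (sym (suc-pred (size T) {{>-nonZero (<⇒≤ 2≤T)}})) tree
... | t , φ = build ∣ t ∣ t ≤-refl (subst (2 ≤_) size-eq 2≤T) (Rigid-resp φ (automorphisms-trivial⇒Rigid {T} triv)) T φ 2≤T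
  where
  size-eq : size T ≡ ∣ t ∣
  size-eq = ↔⇒≡ (↔-trans (Iso⇒↔ φ) (↔-sym (enumeration t)))
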